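{- Let $n$ and $d$ be non-negative integers. (1) If $n\ge 2$ and there exists an undirected graph on $n$ vertices with positive edge weights whose Global Cut Dimension is $d$, then the query complexity of Non-Trivial Symmetric SFM on $n$ elements is at least $d$. (2) If there exists a graph (directed or undirected) with positive edge weights, with two distinct distinguished vertices $s,t$ and exactly $n$ other vertices, whose $s$-$t$ Cut Dimension is $d$, then the query complexity of SFM on $n$ elements is at least $d$. (3) If $n\ge 2$ and there exists a directed graph on $n$ vertices with positive edge weights whose Global Cut Dimension is $d$, then the query complexity of Non-Trivial SFM on $n$ elements is at least $d$.
   Context: Submodular minimization. Let $[n]=\{1,\dots,n\}$. A function $f:2^{[n]}\to\mathbb{R}$ is submodular if $f(X\cup Y)+f(X\cap Y)\le f(X)+f(Y)$ for all $X,Y\subseteq[n]$, and symmetric if $f(S)=f([n]\setminus S)$ for all $S$. SFM: given black-box access to a submodular $f$ (each query is a set $S\subseteq[n]$ and returns $f(S)$; queries may be adaptive), output an element of $\arg\min_S f(S)$ along with $\min_S f(S)$. Non-Trivial SFM: the same with the minimum taken over $S\notin\{\emptyset,[n]\}$. Non-Trivial Symmetric SFM: Non-Trivial SFM with the input $f$ promised to be symmetric. The query complexity of a problem on $n$ elements is the minimum $q(n)$ such that some deterministic algorithm solves it on all instances with $n$ elements using at most $q(n)$ queries. Cut dimension. Let $G$ be a finite graph with vertex set $V$, $m$ edges and positive real edge weights. For a directed graph and $S\subseteq V$, the edge $e$ is cut by $S$ if its left endpoint (tail) is in $S$ and its right endpoint (head) is not in $S$; for an undirected graph, $e$ is cut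 by $S$ if exactly one of its endpoints is in $S$. The value of the cut $S$ is the total weight of the edges cut by $S$. Let $\vec v^{\,S}\in\mathbb{R}^m$ be the vector with $v^S_e=1$ if $e$ is cut by $S$ and $v^S_e=0$ otherwise. Global Cut Dimension of $G$: the dimension of $\mathrm{span}\{\vec v^{\,S}: S \text{ is a global mincut}\}$, where a global mincut is a set $S\subseteq V$ with $S\notin\{\emptyset,V\}$ of minimum cut value among all such sets. $s$-$t$ Cut Dimension of $G$: for distinct vertices $s,t$ and $S\subseteq V\setminus\{s,t\}$, let $\vec v^{\,S}$ instead denote the indicator vector of the edges cut by $S\cup\{s\}$; the $s$-$t$ Cut Dimension is the dimension of the span of the vectors $\vec v^{\,S}$ over all $S\subseteq V\setminus\{s,t\}$ such that $S\cup\{s\}$ has minimum cut value among all sets containing $s$ and not $t$. -}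

module Defs where

open import Data.Bool using (Bool; true; false; _∧_; _xor_; not; if_then_else_)
open import Data.Fin using (Fin)
open import Data.Fin.Subset using (Subset; _∈_; _∉_; _∪_; _∩_; ∁; ⁅_⁆; ⊥; ⊤)
open import Data.Nat as ℕ using (ℕ; zero; suc; _⊔_)
import Data.Nat.Properties as ℕ
open import Data.Product using (∃; _×_; _,_; proj₁; proj₂)
open import Data.Rational as ℚ using (ℚ; 0ℚ; 1ℚ; ½)
import Data.Rational.Properties as ℚ
open import Data.Rational.Solver using (module +-*-Solver)
import Data.Unit as Unit
open import Data.Vec using (lookup)
open import Data.Vec.Functional using (Vector; foldr)
open import Relation.Binary.PropositionalEquality
  using (_≡_; _≢_; refl; sym; trans; cong; subst)

------------------------------------------------------------------------
-- Real numbers: Cauchy sequences of rationals, with equality _≈_ meaning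
-- that the difference tends to zero.

Cauchy : (ℕ → ℚ) → Set
Cauchy x = ∀ ε → 0ℚ ℚ.< ε →
  ∃ λ N → ∀ m n → N ℕ.≤ m → N ℕ.≤ n → ℚ.∣ x m ℚ.- x n ∣ ℚ.≤ ε

record ℝ : Set where
  constructor mkℝ
  field
    seq    : ℕ → ℚ
    cauchy : Cauchy seq

open ℝ public

infix 4 _≈_ _≤_ _<_

_≈_ : ℝ → ℝ → Set
x ≈ y = ∀ ε → 0ℚ ℚ.< ε →
  ∃ λ N → ∀ n → N ℕ.≤ n → ℚ.∣ seq x n ℚ.- seq y n ∣ ℚ.≤ ε

_≤_ : ℝ → ℝ → Set
x ≤ y = ∀ ε → 0ℚ ℚ.< ε →
  ∃ λ N → ∀ n → N ℕ.≤ n → seq x n ℚ.≤ seq y n ℚ.+ ε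

_<_ : ℝ → ℝ → Set
x < y = ∃ λ ε → 0ℚ ℚ.< ε ×
  ∃ λ N → ∀ n → N ℕ.≤ n → seq x n ℚ.+ ε ℚ.≤ seq y n

fromℚ : ℚ → ℝ
fromℚ q = mkℝ (λ _ → q) λ ε 0<ε → 0 , λ _ _ _ _ →
  subst (ℚ._≤ ε) (sym (cong ℚ.∣_∣ (ℚ.+-inverseʳ q))) (ℚ.<⇒≤ 0<ε)

0ℝ 1ℝ : ℝ
0ℝ = fromℚ 0ℚ
1ℝ = fromℚ 1ℚ

private
  +-cauchy : ∀ {x y} → Cauchy x → Cauchy y → Cauchy (λ n → x n ℚ.+ y n)
  +-cauchy {x} {y} cx cy ε 0<ε = proj₁ X ⊔ proj₁ Y , λ m n N≤m N≤n →
    let open ℚ.≤-Reasoning in begin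
      ℚ.∣ (x m ℚ.+ y m) ℚ.- (x n ℚ.+ y n) ∣
        ≡⟨ cong ℚ.∣_∣ (regroup (x m) (y m) (x n) (y n)) ⟩
      ℚ.∣ (x m ℚ.- x n) ℚ.+ (y m ℚ.- y n) ∣
        ≤⟨ ℚ.∣p+q∣≤∣p∣+∣q∣ (x m ℚ.- x n) (y m ℚ.- y n) ⟩
      ℚ.∣ x m ℚ.- x n ∣ ℚ.+ ℚ.∣ y m ℚ.- y n ∣
        ≤⟨ ℚ.+-mono-≤
             (proj₂ X m n (ℕ.m⊔n≤o⇒m≤o _ _ N≤m) (ℕ.m⊔n≤o⇒m≤o _ _ N≤n))
             (proj₂ Y m n (ℕ.m⊔n≤o⇒n≤o (proj₁ X) _ N≤m)
                          (ℕ.m⊔n≤o⇒n≤o (proj₁ X) _ N≤n)) ⟩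
      ½ ℚ.* ε ℚ.+ ½ ℚ.* ε
        ≡⟨ halves ε ⟩
      ε ∎
    where
    0<½ε : 0ℚ ℚ.< ½ ℚ.* ε
    0<½ε = ℚ.positive⁻¹ _ {{ℚ.pos*pos⇒pos ½ ε {{ℚ.positive 0<ε}}}}
    X = cx (½ ℚ.* ε) 0<½ε
    Y = cy (½ ℚ.* ε) 0<½ε
    regroup : ∀ a b c d →
      (a ℚ.+ b) ℚ.- (c ℚ.+ d) ≡ (a ℚ.- c) ℚ.+ (b ℚ.- d)
    regroup = solve 4 (λ a b c d →
      (a :+ b) :- (c :+ d) := (a :- c) :+ (b :- d)) refl
      where open +-*-Solver
    halves : ∀ e → ½ ℚ.* e ℚ.+ ½ ℚ.* e ≡ e
    halves e = trans (sym (ℚ.*-distribʳ-+ e ½ ½))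
      (trans (cong (ℚ._* e) ½+½≡1) (ℚ.*-identityˡ e))
      where
      ½+½≡1 : ½ ℚ.+ ½ ≡ 1ℚ
      ½+½≡1 = refl

  eventuallyBounded : ∀ {x} → Cauchy x →
    ∃ λ K → 0ℚ ℚ.< K × ∃ λ N → ∀ n → N ℕ.≤ n → ℚ.∣ x n ∣ ℚ.≤ K
  eventuallyBounded {x} cx =
    1ℚ ℚ.+ ℚ.∣ x N ∣ ,
    ℚ.+-mono-<-≤ (ℚ.positive⁻¹ 1ℚ) (ℚ.0≤∣p∣ (x N)) ,
    N , λ n N≤n → let open ℚ.≤-Reasoning in begin
      ℚ.∣ x n ∣
        ≡⟨ cong ℚ.∣_∣ (split (x n) (x N)) ⟩
      ℚ.∣ (x n ℚ.- x N) ℚ.+ x N ∣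
        ≤⟨ ℚ.∣p+q∣≤∣p∣+∣q∣ (x n ℚ.- x N) (x N) ⟩
      ℚ.∣ x n ℚ.- x N ∣ ℚ.+ ℚ.∣ x N ∣
        ≤⟨ ℚ.+-monoˡ-≤ ℚ.∣ x N ∣ (proj₂ X n N N≤n ℕ.≤-refl) ⟩
      1ℚ ℚ.+ ℚ.∣ x N ∣ ∎
    where
    X = cx 1ℚ (ℚ.positive⁻¹ 1ℚ)
    N = proj₁ X
    split : ∀ a b → a ≡ (a ℚ.- b) ℚ.+ b
    split = solve 2 (λ a b → a := (a :- b) :+ b) refl
      where open +-*-Solver

  product≤ : ∀ p q {P Q} → ℚ.∣ p ∣ ℚ.≤ P → ℚ.∣ q ∣ ℚ.≤ Q → 0ℚ ℚ.< P →
             ℚ.∣ p ℚ.* q ∣ ℚ.≤ P ℚ.* Q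
  product≤ p q {P} {Q} p≤P q≤Q 0<P = let open ℚ.≤-Reasoning in begin
    ℚ.∣ p ℚ.* q ∣
      ≡⟨ ℚ.∣p*q∣≡∣p∣*∣q∣ p q ⟩
    ℚ.∣ p ∣ ℚ.* ℚ.∣ q ∣
      ≤⟨ ℚ.*-monoʳ-≤-nonNeg ℚ.∣ q ∣ {{ℚ.nonNegative (ℚ.0≤∣p∣ q)}} p≤P ⟩
    P ℚ.* ℚ.∣ q ∣
      ≤⟨ ℚ.*-monoˡ-≤-nonNeg P {{ℚ.nonNegative (ℚ.<⇒≤ 0<P)}} q≤Q ⟩
    P ℚ.* Q ∎

  quotient : ∀ M ε → 0ℚ ℚ.< M → 0ℚ ℚ.< ε → ∃ λ δ → 0ℚ ℚ.< δ × M ℚ.* δ ≡ ε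
  quotient M ε 0<M 0<ε =
    (ℚ.1/ M) ℚ.* ε ,
    ℚ.positive⁻¹ _
      {{ℚ.pos*pos⇒pos (ℚ.1/ M) {{ℚ.1/pos⇒pos M}} ε {{ℚ.positive 0<ε}}}} ,
    trans (sym (ℚ.*-assoc M (ℚ.1/ M) ε))
      (trans (cong (ℚ._* ε) (ℚ.*-inverseʳ M)) (ℚ.*-identityˡ ε))
    where
    instance
      M-positive : ℚ.Positive M
      M-positive = ℚ.positive 0<M
      M-nonZero : ℚ.NonZero M
      M-nonZero = ℚ.pos⇒nonZero M

  *-cauchy : ∀ {x y} → Cauchy x → Cauchy y → Cauchy (λ n → x n ℚ.* y n)
  *-cauchy {x} {y} cx cy ε 0<ε =
    let K , 0<K , A , x≤K = eventuallyBounded {x} cx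
        L , 0<L , B , y≤L = eventuallyBounded {y} cy
        δ , 0<δ , Mδ≡ε    = quotient (K ℚ.+ L) ε (ℚ.+-mono-< 0<K 0<L) 0<ε
        C , X             = cx δ 0<δ
        D , Y             = cy δ 0<δ
    in (A ⊔ B) ⊔ (C ⊔ D) , λ m n N≤m N≤n →
    let open ℚ.≤-Reasoning
        A⊔B≤m = ℕ.m⊔n≤o⇒m≤o (A ⊔ B) (C ⊔ D) N≤m
        A⊔B≤n = ℕ.m⊔n≤o⇒m≤o (A ⊔ B) (C ⊔ D) N≤n
        C⊔D≤m = ℕ.m⊔n≤o⇒n≤o (A ⊔ B) (C ⊔ D) N≤m
        C⊔D≤n = ℕ.m⊔n≤o⇒n≤o (A ⊔ B) (C ⊔ D) N≤n
        x-close = X m n (ℕ.m⊔n≤o⇒m≤o C D C⊔D≤m) (ℕ.m⊔n≤o⇒m≤o C D C⊔D≤n)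
        y-close = Y m n (ℕ.m⊔n≤o⇒n≤o C D C⊔D≤m) (ℕ.m⊔n≤o⇒n≤o C D C⊔D≤n)
    in begin
      ℚ.∣ x m ℚ.* y m ℚ.- x n ℚ.* y n ∣
        ≡⟨ cong ℚ.∣_∣ (regroup (x m) (y m) (x n) (y n)) ⟩
      ℚ.∣ x m ℚ.* (y m ℚ.- y n) ℚ.+ y n ℚ.* (x m ℚ.- x n) ∣
        ≤⟨ ℚ.∣p+q∣≤∣p∣+∣q∣ (x m ℚ.* (y m ℚ.- y n)) (y n ℚ.* (x m ℚ.- x n)) ⟩
      ℚ.∣ x m ℚ.* (y m ℚ.- y n) ∣ ℚ.+ ℚ.∣ y n ℚ.* (x m ℚ.- x n) ∣
        ≤⟨ ℚ.+-mono-≤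
             (product≤ (x m) (y m ℚ.- y n)
               (x≤K m (ℕ.m⊔n≤o⇒m≤o A B A⊔B≤m)) y-close 0<K)
             (product≤ (y n) (x m ℚ.- x n)
               (y≤L n (ℕ.m⊔n≤o⇒n≤o A B A⊔B≤n)) x-close 0<L) ⟩
      K ℚ.* δ ℚ.+ L ℚ.* δ
        ≡⟨ sym (ℚ.*-distribʳ-+ δ K L) ⟩
      (K ℚ.+ L) ℚ.* δ
        ≡⟨ Mδ≡ε ⟩
      ε ∎
    where
    regroup : ∀ a b c d →
      a ℚ.* b ℚ.- c ℚ.* d ≡ a ℚ.* (b ℚ.- d) ℚ.+ d ℚ.* (a ℚ.- c)
    regroup = solve 4 (λ a b c d →
      a :* b :- c :* d := a :* (b :- d) :+ d :* (a :- c)) refl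
      where open +-*-Solver

infixl 6 _+_
infixl 7 _*_

_+_ : ℝ → ℝ → ℝ
x + y = mkℝ (λ n → seq x n ℚ.+ seq y n)
  (+-cauchy {seq x} {seq y} (cauchy x) (cauchy y))

_*_ : ℝ → ℝ → ℝ
x * y = mkℝ (λ n → seq x n ℚ.* seq y n)
  (*-cauchy {seq x} {seq y} (cauchy x) (cauchy y))

sum : ∀ {k} → Vector ℝ k → ℝ
sum = foldr _+_ 0ℝ

------------------------------------------------------------------------
-- Linear algebra in ℝᵐ

infix 4 _≋_

_≋_ : ∀ {m} → Vector ℝ m → Vector ℝ m → Set
v ≋ w = ∀ e → v e ≈ w e

combination : ∀ {k m} → Vector ℝ k → Vector (Vector ℝ m) k → Vector ℝ m
combination c b e = sum (λ i → c i * b i e)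

Span : ∀ {m} → (Vector ℝ m → Set) → (Vector ℝ m → Set)
Span {m} P v = ∃ λ k → ∃ λ (c : Vector ℝ k) → ∃ λ (b : Vector (Vector ℝ m) k) →
  (∀ i → P (b i)) × v ≋ combination c b

LinearlyIndependent : ∀ {k m} → Vector (Vector ℝ m) k → Set
LinearlyIndependent b =
  ∀ c → combination c b ≋ (λ _ → 0ℝ) → ∀ i → c i ≈ 0ℝ

-- W is meant to be a linear subspace; it has dimension d when it has a basis
-- of d vectors.
HasDimension : ∀ {m} → (Vector ℝ m → Set) → ℕ → Set
HasDimension {m} W d = ∃ λ (b : Vector (Vector ℝ m) d) →
  (∀ i → W (b i)) × LinearlyIndependent b ×
  (∀ v → W v → ∃ λ c → v ≋ combination c b)

------------------------------------------------------------------------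
-- Submodular minimization

SetFunction : ℕ → Set
SetFunction n = Subset n → ℝ

Submodular : ∀ {n} → SetFunction n → Set
Submodular f = ∀ X Y → f (X ∪ Y) + f (X ∩ Y) ≤ f X + f Y

Symmetric : ∀ {n} → SetFunction n → Set
Symmetric f = ∀ S → f S ≈ f (∁ S)

NonTrivial : ∀ {n} → Subset n → Set
NonTrivial S = S ≢ ⊥ × S ≢ ⊤

-- Minimize an Instance over the Feasible sets.
record Problem (n : ℕ) : Set₁ where
  field
    Instance : SetFunction n → Set
    Feasible : Subset n → Set

SFM NonTrivialSFM NonTrivialSymmetricSFM : ∀ n → Problem n
SFM n = record
  { Instance = Submodular
  ; Feasible = λ _ → Unit.⊤
  }
NonTrivialSFM n = record
  { Instance = Submodular
  ; Feasible = NonTrivial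
  }
NonTrivialSymmetricSFM n = record
  { Instance = λ f → Submodular f × Symmetric f
  ; Feasible = NonTrivial
  }

-- A deterministic adaptive algorithm is a decision tree branching over the
-- real number returned by each query.  Trees may inspect the Cauchy sequence
-- representing an answer.  This does not change the query complexity
-- classically: fixing one representative of every real number turns such a
-- tree into one that depends on the real number only.
data Algorithm (n : ℕ) : Set where
  output : Subset n → ℝ → Algorithm n
  query  : Subset n → (ℝ → Algorithm n) → Algorithm n

run : ∀ {n} → Algorithm n → SetFunction n → Subset n × ℝ
run (output S r) f = S , r
run (query S k)  f = run (k (f S)) f

queryCount : ∀ {n} → Algorithm n → SetFunction n → ℕ
queryCount (output S r) f = zero
queryCount (query S k)  f = suc (queryCount (k (f S)) f)

module _ {n : ℕ} (P : Problem n) where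
  open Problem P

  Correct : SetFunction n → Subset n × ℝ → Set
  Correct f (S , r) =
    Feasible S × (∀ T → Feasible T → f S ≤ f T) × r ≈ f S

  SolvableWith : ℕ → Set
  SolvableWith q = ∃ λ (A : Algorithm n) → ∀ f → Instance f →
    Correct f (run A f) × queryCount A f ℕ.≤ q

  -- The query complexity is the minimum of the q with SolvableWith q; it is
  -- at least d exactly when every such q is.  This form does not presuppose
  -- a constructive proof that the minimum is attained.
  QueryComplexityAtLeast : ℕ → Set
  QueryComplexityAtLeast d = ∀ q → SolvableWith q → d ℕ.≤ q

------------------------------------------------------------------------
-- Cuts

-- Finite graphs with positive real edge weights; loops and parallel edges are
-- allowed.  Each edge carries an ordered pair of endpoints, whose order is
-- ignored when the graph is regarded as undirected.
record Graph (N : ℕ) : Set where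
  field
    edges    : ℕ
    tail     : Fin edges → Fin N
    head     : Fin edges → Fin N
    weight   : Fin edges → ℝ
    positive : ∀ e → 0ℝ < weight e

data Orientation : Set where
  directed undirected : Orientation

module _ {N : ℕ} (o : Orientation) (G : Graph N) where
  open Graph G

  isCut : Subset N → Fin edges → Bool
  isCut S e = cutBy o (lookup S (tail e)) (lookup S (head e))
    where
    cutBy : Orientation → Bool → Bool → Bool
    cutBy directed   tail∈S head∈S = tail∈S ∧ not head∈S
    cutBy undirected tail∈S head∈S = tail∈S xor head∈S

  cutValue : Subset N → ℝ
  cutValue S = sum (λ e → if isCut S e then weight e else 0ℝ)

  cutVector : Subset N → Vector ℝ edges
  cutVector S e = if isCut S e then 1ℝ else 0ℝ

  GlobalMincut : Subset N → Set
  GlobalMincut S =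
    NonTrivial S × (∀ T → NonTrivial T → cutValue S ≤ cutValue T)

  GlobalCutDimension : ℕ → Set
  GlobalCutDimension = HasDimension
    (Span (λ v → ∃ λ S → GlobalMincut S × v ≋ cutVector S))

  -- S ranges over the sets avoiding s and t; the cut is S ∪ ⁅ s ⁆.
  STMincut : (s t : Fin N) → Subset N → Set
  STMincut s t S = s ∉ S × t ∉ S ×
    (∀ T → s ∈ T → t ∉ T → cutValue (S ∪ ⁅ s ⁆) ≤ cutValue T)

  STCutDimension : (s t : Fin N) → ℕ → Set
  STCutDimension s t = HasDimension
    (Span (λ v → ∃ λ S → STMincut s t S × v ≋ cutVector (S ∪ ⁅ s ⁆)))

{-# OPTIONS --safe #-}

-- Suppose the algorithm queries Q₁, …, Q_q on the cut function of the weights w.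
-- If z is orthogonal to the cut vectors of all Qᵢ, then the weights w ± εz give,
-- for small ε, instances that the algorithm cannot tell from w, so they all have
-- the same minimum; hence z is orthogonal to the cut vector of every mincut.
-- In particular a combination z of mincut vectors that is orthogonal to the
-- queried cut vectors is orthogonal to itself and vanishes, so that the q linear
-- equations z ⟂ Qᵢ have only the trivial solution on the d-dimensional span of
-- the mincut vectors, and d ≤ q.
module Submission where

open import Algebra.Bundles using (CommutativeRing)
import Algebra.Consequences.Setoid as Consequences
import Algebra.Properties.Ring as RingProperties
import Algebra.Properties.Semiring.Sum as SemiringSum
open import Data.Bool using (Bool; true; false; T; _∧_; _∨_; _xor_; not; if_then_else_)
open import Data.Empty using (⊥-elim)
open import Data.Fin using (Fin; zero; suc; punchIn; punchOut)
open import Data.Nat as ℕ using (zero; suc; _⊔_)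
import Data.Nat.Properties as ℕ
open import Data.Product using (_,_; proj₁; proj₂)
open import Data.Vec.Functional using (Vector; insertAt; removeAt)
open import Data.Vec.Functional.Properties using (insertAt-lookup; insertAt-punchIn)
open import Level using (0ℓ)
open import Relation.Binary.Bundles using (Setoid)
open import Relation.Binary.PropositionalEquality as ≡ using (_≡_)
import Relation.Binary.Reasoning.Setoid as SetoidReasoning
open import Relation.Nullary using (¬_; yes; no)

-- Two obstacles shape the argument. Equality of these reals is undecidable, and a real known only
-- to be nonzero cannot be inverted constructively. The dimension count is therefore done over a
-- commutative ring with three weak properties: one differs from zero, being zero is stable under
-- double negation, and a nonzero factor can be cancelled. The other is that identical runs do not
-- by themselves give orthogonality. They return one set and one value for both instances, so a
-- mincut of the original weights cannot become cheaper than it was: moving along `z` yields only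
-- that the weight of `z` on the mincut is nonnegative. The move along the negative of `z` gives the
-- opposite inequality. A step length must keep every edge weight nonnegative, for this is what
-- makes the perturbed cut function submodular; it comes from a positive rational below each weight
-- and a rational bound on each entry of `z`.

-- Inner products and elimination over a commutative ring.

module LinearAlgebra (R : CommutativeRing 0ℓ 0ℓ) where
  open CommutativeRing R hiding (zero) renaming (Carrier to A)
  open RingProperties ring using (-‿distribˡ-*; -‿distribʳ-*)
  open SemiringSum semiring
  open SetoidReasoning setoid

  sum-zero : ∀ {k} {x : Vector A k} → (∀ i → x i ≈ 0#) → sum x ≈ 0#
  sum-zero {k} {x} x≈0 = trans (sum-cong-≋ x≈0) (sum-replicate-zero k)

  infix 7 _∙_

  _∙_ : ∀ {k} → Vector A k → Vector A k → A
  x ∙ y = sum (λ e → x e * y e)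

  ∙-cong : ∀ {k} {x x′ y y′ : Vector A k} →
           (∀ e → x e ≈ x′ e) → (∀ e → y e ≈ y′ e) → x ∙ y ≈ x′ ∙ y′
  ∙-cong p q = sum-cong-≋ λ e → *-cong (p e) (q e)

  ∙-comm : ∀ {k} (x y : Vector A k) → x ∙ y ≈ y ∙ x
  ∙-comm x y = sum-cong-≋ λ e → *-comm (x e) (y e)

  ∙-* : ∀ {k} a (x y : Vector A k) → (λ e → a * x e) ∙ y ≈ a * (x ∙ y)
  ∙-* a x y = trans (sum-cong-≋ λ e → *-assoc a (x e) (y e))
    (sym (*-distribˡ-sum a (λ e → x e * y e)))

  ∙-+ : ∀ {k} (x y z : Vector A k) → (λ e → x e + y e) ∙ z ≈ x ∙ z + y ∙ z
  ∙-+ x y z = trans (sum-cong-≋ λ e → distribʳ (z e) (x e) (y e))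
    (∑-distrib-+ (λ e → x e * z e) (λ e → y e * z e))

  ∙-combination : ∀ {k m} (x : Vector A m) (c : Vector A k) (b : Vector (Vector A m) k) →
                  x ∙ (λ e → c ∙ (λ i → b i e)) ≈ c ∙ (λ i → x ∙ b i)
  ∙-combination x c b = begin
    sum (λ e → x e * sum (λ i → c i * b i e))
      ≈⟨ sum-cong-≋ (λ e → *-distribˡ-sum (x e) (λ i → c i * b i e)) ⟩
    sum (λ e → sum (λ i → x e * (c i * b i e)))
      ≈⟨ ∑-comm (λ e i → x e * (c i * b i e)) ⟩
    sum (λ i → sum (λ e → x e * (c i * b i e)))
      ≈⟨ sum-cong-≋ (λ i → sum-cong-≋ λ e → swap (x e) (c i) (b i e)) ⟩
    sum (λ i → sum (λ e → c i * (x e * b i e)))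
      ≈⟨ sum-cong-≋ (λ i → sym (*-distribˡ-sum (c i) (λ e → x e * b i e))) ⟩
    sum (λ i → c i * (x ∙ b i)) ∎
    where
    swap : ∀ p q r → p * (q * r) ≈ q * (p * r)
    swap p q r = trans (sym (*-assoc p q r)) (trans (*-congʳ (*-comm p q)) (*-assoc q p r))

  ⟂-combination : ∀ {k m} (x v : Vector A m) (c : Vector A k) (b : Vector (Vector A m) k) →
                  (∀ e → v e ≈ c ∙ (λ i → b i e)) → (∀ i → x ∙ b i ≈ 0#) → x ∙ v ≈ 0#
  ⟂-combination x v c b v≈cb x⟂b = begin
    x ∙ v                            ≈⟨ ∙-cong {x = x} (λ _ → refl) v≈cb ⟩
    x ∙ (λ e → c ∙ (λ i → b i e))    ≈⟨ ∙-combination x c b ⟩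
    c ∙ (λ i → x ∙ b i)              ≈⟨ sum-zero (λ i → trans (*-congˡ (x⟂b i)) (zeroʳ (c i))) ⟩
    0#                               ∎

  -- Cross-multiplication keeps the elimination free of divisions.
  eliminate : ∀ {d} → Vector A (suc d) → Fin (suc d) → Vector A (suc d) → Vector A d
  eliminate r p x j = r p * x (punchIn p j) + r (punchIn p j) * - x p

  -- The coordinate at `p` is chosen to make the result orthogonal to `r`; scaling the others by
  -- `r p` clears its denominator.
  lift : ∀ {d} → Vector A (suc d) → Fin (suc d) → Vector A d → Vector A (suc d)
  lift r p c = insertAt (λ j → r p * c j) p (- (c ∙ removeAt r p))

  -- `lift r p` and `eliminate r p` are transposes of each other, which turns equations on a lifted
  -- vector into equations of the reduced system.
  lift-∙ : ∀ {d} (r : Vector A (suc d)) p c x → lift r p c ∙ x ≈ c ∙ eliminate r p x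
  lift-∙ r p c x = begin
    lift r p c ∙ x
      ≈⟨ sum-remove {i = p} (λ j → lift r p c j * x j) ⟩
    lift r p c p * x p + sum (λ j → lift r p c (punchIn p j) * x (punchIn p j))
      ≈⟨ +-cong
           (*-congʳ (reflexive (insertAt-lookup (λ j → r p * c j) p _)))
           (sum-cong-≋ λ j → *-congʳ (reflexive (insertAt-punchIn (λ j → r p * c j) p _ j))) ⟩
    - (c ∙ removeAt r p) * x p + sum (λ j → r p * c j * x (punchIn p j))
      ≈⟨ +-comm _ _ ⟩
    sum (λ j → r p * c j * x (punchIn p j)) + - (c ∙ removeAt r p) * x p
      ≈⟨ +-congˡ (trans (sym (-‿distribˡ-* _ _)) (-‿distribʳ-* _ _)) ⟩
    sum (λ j → r p * c j * x (punchIn p j)) + (c ∙ removeAt r p) * - x p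
      ≈⟨ +-congˡ (*-distribʳ-sum (- x p) (λ j → c j * removeAt r p j)) ⟩
    sum (λ j → r p * c j * x (punchIn p j)) + sum (λ j → c j * r (punchIn p j) * - x p)
      ≈⟨ sym (∑-distrib-+ _ (λ j → c j * r (punchIn p j) * - x p)) ⟩
    sum (λ j → r p * c j * x (punchIn p j) + c j * r (punchIn p j) * - x p)
      ≈⟨ sum-cong-≋ (λ j → sym (term (c j) (r p) (x (punchIn p j)) (r (punchIn p j)))) ⟩
    c ∙ eliminate r p x ∎
    where
    term : ∀ a b y z → a * (b * y + z * - x p) ≈ b * a * y + a * z * - x p
    term a b y z = trans (distribˡ a (b * y) (z * - x p)) (+-cong
      (trans (sym (*-assoc a b y)) (*-congʳ (*-comm a b)))
      (sym (*-assoc a z (- x p))))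

  eliminate-self : ∀ {d} (r : Vector A (suc d)) p j → eliminate r p r j ≈ 0#
  eliminate-self r p j = begin
    r p * r (punchIn p j) + r (punchIn p j) * - r p
      ≈⟨ +-cong (*-comm _ _) (sym (-‿distribʳ-* _ _)) ⟩
    r (punchIn p j) * r p - r (punchIn p j) * r p
      ≈⟨ -‿inverseʳ _ ⟩
    0# ∎

  TrivialKernel : ∀ {q d} → (Fin q → Vector A d) → Set
  TrivialKernel M = ∀ c → (∀ i → c ∙ M i ≈ 0#) → ∀ j → c j ≈ 0#

  module _ (1≉0 : ¬ 1# ≈ 0#)
           (≈0-stable : ∀ {x} → ¬ ¬ x ≈ 0# → x ≈ 0#)
           (integral : ∀ {x y} → x * y ≈ 0# → ¬ x ≈ 0# → y ≈ 0#) where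

    -- A kernel vector of the reduced system lifts to one of `M`, because the pivot row reduces to
    -- zero against itself. The lift vanishes by hypothesis, and away from `p` its coordinates are
    -- the `c j` times the pivot, which cancels.
    eliminate-trivialKernel : ∀ {q d} (M : Fin (suc q) → Vector A (suc d)) p →
      ¬ M zero p ≈ 0# → TrivialKernel M →
      TrivialKernel (λ i → eliminate (M zero) p (M (suc i)))
    eliminate-trivialKernel M p pivot≉0 trivial c c∙M′≈0 j = integral lifted pivot≉0
      where
      r = M zero
      c∙M≈0 : ∀ i → lift r p c ∙ M i ≈ 0#
      c∙M≈0 zero = trans (lift-∙ r p c r)
        (sum-zero λ j → trans (*-congˡ (eliminate-self r p j)) (zeroʳ (c j)))
      c∙M≈0 (suc i) = trans (lift-∙ r p c (M (suc i))) (c∙M′≈0 i)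
      lifted : r p * c j ≈ 0#
      lifted = trans (reflexive (≡.sym (insertAt-punchIn (λ j → r p * c j) p _ j)))
        (trivial (lift r p c) c∙M≈0 (punchIn p j))

    -- Since d ≤ q is decidable, the search for a pivot may be classical.
    trivialKernel⇒≤ : ∀ q d (M : Fin q → Vector A d) → TrivialKernel M → d ℕ.≤ q
    trivialKernel⇒≤ q zero M trivial = ℕ.z≤n
    trivialKernel⇒≤ zero (suc d) M trivial =
      -- With no equations every vector is in the kernel, including the all-ones vector.
      ⊥-elim (1≉0 (trivial (λ _ → 1#) (λ ()) zero))
    trivialKernel⇒≤ (suc q) (suc d) M trivial with suc d ℕ.≤? suc q
    ... | yes d≤q = d≤q
    -- A nonzero entry of the first row would serve as pivot and yield `d ≤ q`, against `d≰q`. The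
    -- row is therefore zero, imposes nothing, and is dropped.
    ... | no  d≰q = ℕ.m≤n⇒m≤1+n (trivialKernel⇒≤ q (suc d) (λ i → M (suc i))
      λ c c∙M≈0 → trivial c λ where
        zero    → sum-zero λ j → trans (*-congˡ (row≈0 j)) (zeroʳ (c j))
        (suc i) → c∙M≈0 i)
      where
      row≈0 : ∀ p → M zero p ≈ 0#
      row≈0 p = ≈0-stable λ pivot≉0 → d≰q (ℕ.s≤s (trivialKernel⇒≤ q d _
        (eliminate-trivialKernel M p pivot≉0 trivial)))

  -- Weights summed over a set of edges.

  infix 7 _↾_

  -- Written with `if` so that it has the very form of `cutValue`; `↾≈∙` passes to the inner product
  -- with a cut vector.
  _↾_ : ∀ {k} → Vector A k → (Fin k → Bool) → A
  x ↾ χ = sum (λ e → if χ e then x e else 0#)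

  indicator : ∀ {k} → (Fin k → Bool) → Vector A k
  indicator χ e = if χ e then 1# else 0#

  ↾≈∙ : ∀ {k} (x : Vector A k) χ → x ↾ χ ≈ x ∙ indicator χ
  ↾≈∙ x χ = sum-cong-≋ λ e → term (χ e) (x e)
    where
    term : ∀ b y → (if b then y else 0#) ≈ y * (if b then 1# else 0#)
    term true  y = sym (*-identityʳ y)
    term false y = sym (zeroʳ y)

  ↾-* : ∀ {k} a (x : Vector A k) χ → (λ e → a * x e) ↾ χ ≈ a * (x ↾ χ)
  ↾-* a x χ = begin
    (λ e → a * x e) ↾ χ             ≈⟨ ↾≈∙ (λ e → a * x e) χ ⟩
    (λ e → a * x e) ∙ indicator χ   ≈⟨ ∙-* a x (indicator χ) ⟩
    a * (x ∙ indicator χ)           ≈⟨ *-congˡ (sym (↾≈∙ x χ)) ⟩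
    a * (x ↾ χ)                     ∎

  ↾-+ : ∀ {k} (x y : Vector A k) χ → (λ e → x e + y e) ↾ χ ≈ x ↾ χ + y ↾ χ
  ↾-+ x y χ = begin
    (λ e → x e + y e) ↾ χ                    ≈⟨ ↾≈∙ (λ e → x e + y e) χ ⟩
    (λ e → x e + y e) ∙ indicator χ          ≈⟨ ∙-+ x y (indicator χ) ⟩
    x ∙ indicator χ + y ∙ indicator χ        ≈⟨ +-cong (sym (↾≈∙ x χ)) (sym (↾≈∙ y χ)) ⟩
    x ↾ χ + y ↾ χ                            ∎

  ↾-shift : ∀ {k} (x : Vector A k) a y χ →
            (λ e → x e + a * y e) ↾ χ ≈ x ↾ χ + a * (y ↾ χ)
  ↾-shift x a y χ = trans (↾-+ x (λ e → a * y e) χ) (+-congˡ (↾-* a y χ))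

  ↾-*-null : ∀ {k} a (x : Vector A k) χ → x ↾ χ ≈ 0# → (λ e → a * x e) ↾ χ ≈ 0#
  ↾-*-null a x χ x≈0 = trans (↾-* a x χ) (trans (*-congˡ x≈0) (zeroʳ a))

  ↾-shift-null : ∀ {k} (x : Vector A k) a y χ → y ↾ χ ≈ 0# →
                 x ↾ χ ≈ (λ e → x e + a * y e) ↾ χ
  ↾-shift-null x a y χ y≈0 = sym (trans (↾-+ x (λ e → a * y e) χ)
    (trans (+-congˡ (↾-*-null a y χ y≈0)) (+-identityʳ (x ↾ χ))))

  -- Positive definiteness and comparison of edge sums.

  module Ordered
    (_≤_ : A → A → Set)
    (≤-reflexive : ∀ {x y} → x ≈ y → x ≤ y)
    (≤-trans : ∀ {x y z} → x ≤ y → y ≤ z → x ≤ z)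
    (≤-antisym : ∀ {x y} → x ≤ y → y ≤ x → x ≈ y)
    (+-mono-≤ : ∀ {x y u v} → x ≤ y → u ≤ v → (x + u) ≤ (y + v))
    where

    sum-mono-≤ : ∀ {k} {x y : Vector A k} → (∀ i → x i ≤ y i) → sum x ≤ sum y
    sum-mono-≤ {zero}  x≤y = ≤-reflexive refl
    sum-mono-≤ {suc k} x≤y = +-mono-≤ (x≤y zero) (sum-mono-≤ λ i → x≤y (suc i))

    -- The other terms sum to at least zero, so `x i` is at most the whole sum.
    sum≈0⇒≈0 : ∀ {k} {x : Vector A k} → (∀ i → 0# ≤ x i) → sum x ≈ 0# → ∀ i → x i ≈ 0#
    sum≈0⇒≈0 {suc k} {x} 0≤x sum≈0 i = ≤-antisym xᵢ≤0 (0≤x i)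
      where
      0≤rest : 0# ≤ sum (removeAt x i)
      0≤rest = ≤-trans (≤-reflexive (sym (sum-replicate-zero k)))
        (sum-mono-≤ λ j → 0≤x (punchIn i j))
      xᵢ≤0 : x i ≤ 0#
      xᵢ≤0 = ≤-trans (≤-reflexive (sym (+-identityʳ (x i))))
        (≤-trans (+-mono-≤ (≤-reflexive refl) 0≤rest)
          (≤-reflexive (trans (sym (sum-remove x)) sum≈0)))

    module _ (1≉0 : ¬ 1# ≈ 0#)
             (≈0-stable : ∀ {x} → ¬ ¬ x ≈ 0# → x ≈ 0#)
             (integral : ∀ {x y} → x * y ≈ 0# → ¬ x ≈ 0# → y ≈ 0#)
             (0≤x² : ∀ x → 0# ≤ (x * x)) where

      -- Cancelling a factor of a square requires that factor to be nonzero. Assuming this for `x e`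
      -- leads to a contradiction, and stability turns the contradiction into `x e ≈ 0#`.
      ∙-definite : ∀ {k} (x : Vector A k) → x ∙ x ≈ 0# → ∀ e → x e ≈ 0#
      ∙-definite x x∙x≈0 e = ≈0-stable λ xₑ≉0 →
        xₑ≉0 (integral (sum≈0⇒≈0 (λ e → 0≤x² (x e)) x∙x≈0 e) xₑ≉0)

      -- A combination of the b j orthogonal to every u i is orthogonal to itself.
      orthogonality⇒≤ : ∀ {q d m} (u : Vector (Vector A m) q) (b : Vector (Vector A m) d) →
        (∀ c → (∀ e → c ∙ (λ j → b j e) ≈ 0#) → ∀ j → c j ≈ 0#) →
        (∀ x → (∀ i → x ∙ u i ≈ 0#) → ∀ j → x ∙ b j ≈ 0#) →
        d ℕ.≤ q
      orthogonality⇒≤ {q} {d} u b independent u⊥⊆b⊥ =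
        trivialKernel⇒≤ 1≉0 ≈0-stable integral q d (λ i j → u i ∙ b j) λ c c∙M≈0 →
          let z = λ e → c ∙ (λ j → b j e)
              z⟂u = λ i → trans (∙-comm z (u i)) (trans (∙-combination (u i) c b) (c∙M≈0 i))
          in independent c (∙-definite z
               (⟂-combination z z c b (λ _ → refl) (u⊥⊆b⊥ z z⟂u)))

    private
      [_]_ : Bool → A → A
      [ p ] x = if p then x else 0#

    exchange : ∀ p q x → [ p ] x + [ q ] x ≈ [ p ∨ q ] x + [ p ∧ q ] x
    exchange true  true  x = refl
    exchange true  false x = refl
    exchange false true  x = +-comm 0# x
    exchange false false x = refl

    []-mono-≤ : ∀ p q {x} → 0# ≤ x → T (not p ∨ q) → ([ p ] x) ≤ ([ q ] x)
    []-mono-≤ true  true  0≤x _ = ≤-reflexive refl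
    []-mono-≤ false true  0≤x _ = 0≤x
    []-mono-≤ false false 0≤x _ = ≤-reflexive refl

    -- Being in at least one of two sets and being in both determine how often an edge is counted,
    -- and `exchange` rewrites each side in these terms. `T (not a ∨ b)` encodes an implication as a
    -- Boolean, so that instances can be checked by evaluation.
    ↾-mono-≤ : ∀ {k} {x : Vector A k} (p q r s : Fin k → Bool) → (∀ e → 0# ≤ x e) →
      (∀ e → T (not (p e ∨ q e) ∨ (r e ∨ s e))) →
      (∀ e → T (not (p e ∧ q e) ∨ (r e ∧ s e))) →
      (x ↾ p + x ↾ q) ≤ (x ↾ r + x ↾ s)
    ↾-mono-≤ {x = x} p q r s 0≤x ∨-imp ∧-imp =
      ≤-trans (≤-reflexive (sym (∑-distrib-+ (λ e → [ p e ] x e) (λ e → [ q e ] x e))))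
      (≤-trans (sum-mono-≤ λ e →
        ≤-trans (≤-reflexive (exchange (p e) (q e) (x e)))
        (≤-trans (+-mono-≤ ([]-mono-≤ (p e ∨ q e) (r e ∨ s e) (0≤x e) (∨-imp e))
                           ([]-mono-≤ (p e ∧ q e) (r e ∧ s e) (0≤x e) (∧-imp e)))
          (≤-reflexive (sym (exchange (r e) (s e) (x e))))))
      (≤-reflexive (∑-distrib-+ (λ e → [ r e ] x e) (λ e → [ s e ] x e))))

open import Defs hiding (_+_)
open import Data.Nat using (ℕ; _+_) renaming (_≤_ to _≤ᴺ_)
open import Data.Product using (∃; _×_)
open import Relation.Binary.PropositionalEquality using (_≢_)

import Defs
import Data.Bool.Properties as Bool
open import Data.Fin.Properties using (punchIn-punchOut)
open import Data.Fin.Subset using (Subset; _∈_; _∉_; _∪_; _∩_; ∁; ⁅_⁆)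
open import Data.Fin.Subset.Properties using (x∈⁅x⁆; x∈⁅y⁆⇒x≡y; x∈p∪q⁺; x∈p∪q⁻)
import Data.Integer as ℤ
open import Data.List as List using (List; []; _∷_; length)
open import Data.List.Membership.Propositional using () renaming (_∈_ to _∈ᴸ_)
import Data.List.Membership.DecPropositional as DecMembership
import Data.List.Relation.Unary.Any as Any
open import Data.List.Relation.Unary.Any using (here; there)
open import Data.List.Relation.Unary.Any.Properties using (lookup-index)
open import Data.Rational as ℚ using (ℚ; 0ℚ; 1ℚ; ½; ∣_∣)
import Data.Rational.Properties as ℚ
open import Data.Rational.Solver using (module +-*-Solver)
open import Data.Sum using (_⊎_; inj₁; inj₂; [_,_]′)
open import Data.Unit using (tt)
open import Data.Vec as Vec using (Vec; _∷_; lookup; zipWith)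
open import Data.Vec.Properties as Vec
  using (≡-dec; lookup-zipWith; lookup-map; lookup⇒[]=; []=⇒lookup)
open import Relation.Binary.PropositionalEquality
  using (refl; sym; trans; cong; cong₂; subst; subst₂; module ≡-Reasoning)

open +-*-Solver using (solve; _:+_; _:*_; _:-_; :-_; _:=_; con)

-- Estimates on rational numbers.

private
  variable
    a b ε : ℚ

0<1 : 0ℚ ℚ.< 1ℚ
0<1 = ℚ.positive⁻¹ 1ℚ

*-pos : 0ℚ ℚ.< a → 0ℚ ℚ.< b → 0ℚ ℚ.< a ℚ.* b
*-pos {a} {b} 0<a 0<b =
  ℚ.positive⁻¹ _ {{ℚ.pos*pos⇒pos a {{ℚ.positive 0<a}} b {{ℚ.positive 0<b}}}}

½-pos : 0ℚ ℚ.< ε → 0ℚ ℚ.< ½ ℚ.* ε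
½-pos = *-pos (ℚ.positive⁻¹ ½)

halves : ∀ ε → ½ ℚ.* ε ℚ.+ ½ ℚ.* ε ≡ ε
halves = solve 1 (λ ε → con ½ :* ε :+ con ½ :* ε := ε) refl

*-quotient : ∀ a b → 0ℚ ℚ.< a → 0ℚ ℚ.< b →
             ∃ λ c → 0ℚ ℚ.< c × c ℚ.* a ≡ b
*-quotient a b 0<a 0<b = b ℚ.* 1/a , *-pos 0<b (ℚ.positive⁻¹ 1/a {{ℚ.1/pos⇒pos a}}) ,
  trans (ℚ.*-assoc b 1/a a)
    (trans (cong (b ℚ.*_) (ℚ.*-inverseˡ a)) (ℚ.*-identityʳ b))
  where
  instance
    a-pos = ℚ.positive 0<a
    a-nonZero = ℚ.pos⇒nonZero a
  1/a = ℚ.1/ a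

p≤∣p∣ : ∀ p → p ℚ.≤ ∣ p ∣
p≤∣p∣ p with ℚ.∣p∣≡p∨∣p∣≡-p p
... | inj₁ eq = ℚ.≤-reflexive (sym eq)
... | inj₂ eq = ℚ.≤-trans p≤0 (ℚ.0≤∣p∣ p)
  where
  p≤0 : p ℚ.≤ 0ℚ
  p≤0 = subst (ℚ._≤ 0ℚ) (solve 1 (λ p → :- (:- p) := p) refl p)
    (ℚ.neg-antimono-≤ (subst (0ℚ ℚ.≤_) eq (ℚ.0≤∣p∣ p)))

∣p∣≤ : ∀ p → p ℚ.≤ ε → ℚ.- p ℚ.≤ ε → ∣ p ∣ ℚ.≤ ε
∣p∣≤ p p≤ε -p≤ε with ℚ.∣p∣≡p∨∣p∣≡-p p
... | inj₁ eq = subst (ℚ._≤ _) (sym eq) p≤ε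
... | inj₂ eq = subst (ℚ._≤ _) (sym eq) -p≤ε

∣∣-≤⇒≤+ : ∀ a b → ∣ a ℚ.- b ∣ ℚ.≤ ε → a ℚ.≤ b ℚ.+ ε
∣∣-≤⇒≤+ {ε} a b h = begin
  a                     ≡⟨ solve 2 (λ a b → a := b :+ (a :- b)) refl a b ⟩
  b ℚ.+ (a ℚ.- b)       ≤⟨ ℚ.+-monoʳ-≤ b (ℚ.≤-trans (p≤∣p∣ _) h) ⟩
  b ℚ.+ ε               ∎
  where open ℚ.≤-Reasoning

∣∣-≤⇒≥- : ∀ a b → ∣ a ℚ.- b ∣ ℚ.≤ ε → b ℚ.≤ a ℚ.+ ε
∣∣-≤⇒≥- a b h = ∣∣-≤⇒≤+ b a (subst (ℚ._≤ _)
  (trans (sym (ℚ.∣-p∣≡∣p∣ (a ℚ.- b)))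
    (cong ∣_∣ (solve 2 (λ a b → :- (a :- b) := b :- a) refl a b))) h)

≤+⇒-≤ : ∀ a b → a ℚ.≤ b ℚ.+ ε → a ℚ.- b ℚ.≤ ε
≤+⇒-≤ {ε} a b h = subst (a ℚ.- b ℚ.≤_)
  (solve 2 (λ b ε → (b :+ ε) :- b := ε) refl b ε) (ℚ.+-monoˡ-≤ (ℚ.- b) h)

≤+⇒∣∣-≤ : ∀ a b → a ℚ.≤ b ℚ.+ ε → b ℚ.≤ a ℚ.+ ε → ∣ a ℚ.- b ∣ ℚ.≤ ε
≤+⇒∣∣-≤ a b a≤ b≤ = ∣p∣≤ (a ℚ.- b) (≤+⇒-≤ a b a≤)
  (subst (ℚ._≤ _) (solve 2 (λ a b → b :- a := :- (a :- b)) refl a b) (≤+⇒-≤ b a b≤))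

-- The ordered commutative ring of reals.

Eventually : (ℕ → Set) → Set
Eventually P = ∃ λ N → ∀ n → N ℕ.≤ n → P n

always : ∀ {P : ℕ → Set} → (∀ n → P n) → Eventually P
always p = 0 , λ n _ → p n

eventually-map : ∀ {P Q : ℕ → Set} → (∀ n → P n → Q n) →
                 Eventually P → Eventually Q
eventually-map f (N , p) = N , λ n N≤n → f n (p n N≤n)

eventually-zip : ∀ {P Q R : ℕ → Set} → (∀ n → P n → Q n → R n) →
                 Eventually P → Eventually Q → Eventually R
eventually-zip f (M , p) (N , q) = M ⊔ N , λ n M⊔N≤n →
  f n (p n (ℕ.m⊔n≤o⇒m≤o M N M⊔N≤n)) (q n (ℕ.m⊔n≤o⇒n≤o M N M⊔N≤n))

bounded : ∀ x → ∃ λ K → 0ℚ ℚ.< K × Eventually (λ n → ∣ seq x n ∣ ℚ.≤ K)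
bounded x = K , ℚ.+-mono-<-≤ 0<1 (ℚ.0≤∣p∣ (seq x N)) , N , λ n N≤n → begin
  ∣ seq x n ∣
    ≡⟨ cong ∣_∣ (solve 2 (λ a b → a := (a :- b) :+ b) refl (seq x n) (seq x N)) ⟩
  ∣ (seq x n ℚ.- seq x N) ℚ.+ seq x N ∣
    ≤⟨ ℚ.∣p+q∣≤∣p∣+∣q∣ (seq x n ℚ.- seq x N) (seq x N) ⟩
  ∣ seq x n ℚ.- seq x N ∣ ℚ.+ ∣ seq x N ∣
    ≤⟨ ℚ.+-monoˡ-≤ ∣ seq x N ∣ (proj₂ X n N N≤n ℕ.≤-refl) ⟩
  K ∎
  where
  open ℚ.≤-Reasoning
  X = cauchy x 1ℚ 0<1
  N = proj₁ X
  K = 1ℚ ℚ.+ ∣ seq x N ∣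

-- The records and the opaque operations below stop _≈_, _≤_, _+_ and _*_ from
-- unfolding into rational arithmetic, where comparing two types is infeasible.
infix 4 _≃_ _≲_

record _≃_ (x y : ℝ) : Set where
  constructor ⌈_⌉
  field ⌊_⌋ : x ≈ y

record _≲_ (x y : ℝ) : Set where
  constructor ⟨_⟩
  field unwrap : x ≤ y

open _≃_
open _≲_

private
  variable
    x y z u v : ℝ

≲-pointwise : Eventually (λ n → seq x n ℚ.≤ seq y n) → x ≲ y
≲-pointwise {y = y} h = ⟨ (λ ε 0<ε → eventually-map
  (λ n xₙ≤yₙ → ℚ.≤-trans xₙ≤yₙ (subst (ℚ._≤ seq y n ℚ.+ ε) (ℚ.+-identityʳ (seq y n))
    (ℚ.+-monoʳ-≤ (seq y n) (ℚ.<⇒≤ 0<ε)))) h) ⟩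

≲-trans : x ≲ y → y ≲ z → x ≲ z
≲-trans {x} {y} {z} x≲y y≲z = ⟨ (λ ε 0<ε → eventually-zip
  (λ n h k → begin
    seq x n                              ≤⟨ h ⟩
    seq y n ℚ.+ ½ ℚ.* ε                  ≤⟨ ℚ.+-monoˡ-≤ (½ ℚ.* ε) k ⟩
    seq z n ℚ.+ ½ ℚ.* ε ℚ.+ ½ ℚ.* ε      ≡⟨ ℚ.+-assoc (seq z n) _ _ ⟩
    seq z n ℚ.+ (½ ℚ.* ε ℚ.+ ½ ℚ.* ε)    ≡⟨ cong (seq z n ℚ.+_) (halves ε) ⟩
    seq z n ℚ.+ ε                        ∎)
  (unwrap x≲y (½ ℚ.* ε) (½-pos 0<ε)) (unwrap y≲z (½ ℚ.* ε) (½-pos 0<ε))) ⟩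
  where open ℚ.≤-Reasoning

≃⇒≲ : x ≃ y → x ≲ y
≃⇒≲ {x} {y} x≃y = ⟨ (λ ε 0<ε →
  eventually-map (λ n → ∣∣-≤⇒≤+ (seq x n) (seq y n)) (⌊ x≃y ⌋ ε 0<ε)) ⟩

≃⇒≳ : x ≃ y → y ≲ x
≃⇒≳ {x} {y} x≃y = ⟨ (λ ε 0<ε →
  eventually-map (λ n → ∣∣-≤⇒≥- (seq x n) (seq y n)) (⌊ x≃y ⌋ ε 0<ε)) ⟩

≲-antisym : x ≲ y → y ≲ x → x ≃ y
≲-antisym {x} {y} x≲y y≲x = ⌈ (λ ε 0<ε →
  eventually-zip (λ n → ≤+⇒∣∣-≤ (seq x n) (seq y n))
    (unwrap x≲y ε 0<ε) (unwrap y≲x ε 0<ε)) ⌉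

≃-pointwise : (∀ n → seq x n ≡ seq y n) → x ≃ y
≃-pointwise h = ≲-antisym
  (≲-pointwise (always λ n → ℚ.≤-reflexive (h n)))
  (≲-pointwise (always λ n → ℚ.≤-reflexive (sym (h n))))

≃-refl : x ≃ x
≃-refl = ≃-pointwise λ _ → refl

≃-sym : x ≃ y → y ≃ x
≃-sym x≃y = ≲-antisym (≃⇒≳ x≃y) (≃⇒≲ x≃y)

≃-trans : x ≃ y → y ≃ z → x ≃ z
≃-trans x≃y y≃z =
  ≲-antisym (≲-trans (≃⇒≲ x≃y) (≃⇒≲ y≃z)) (≲-trans (≃⇒≳ y≃z) (≃⇒≳ x≃y))

infixl 6 _+ᴿ_
infixl 7 _*ᴿ_
infix 8 -ᴿ_

opaque
  _+ᴿ_ _*ᴿ_ : ℝ → ℝ → ℝ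
  _+ᴿ_ = Defs._+_
  _*ᴿ_ = Defs._*_

  -- As a product with a constant, the negative inherits the Cauchy property from multiplication.
  -ᴿ_ : ℝ → ℝ
  -ᴿ x = fromℚ (ℚ.- 1ℚ) * x

opaque
  unfolding _+ᴿ_

  +-mono-≲ : x ≲ y → u ≲ v → x +ᴿ u ≲ y +ᴿ v
  +-mono-≲ {x} {y} {u} {v} x≲y u≲v = ⟨ (λ ε 0<ε → eventually-zip
    (λ n h k → begin
      seq x n ℚ.+ seq u n
        ≤⟨ ℚ.+-mono-≤ h k ⟩
      seq y n ℚ.+ ½ ℚ.* ε ℚ.+ (seq v n ℚ.+ ½ ℚ.* ε)
        ≡⟨ solve 3 (λ y v ε → y :+ con ½ :* ε :+ (v :+ con ½ :* ε) := y :+ v :+ ε)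
             refl (seq y n) (seq v n) ε ⟩
      seq y n ℚ.+ seq v n ℚ.+ ε ∎)
    (unwrap x≲y (½ ℚ.* ε) (½-pos 0<ε)) (unwrap u≲v (½ ℚ.* ε) (½-pos 0<ε))) ⟩
    where open ℚ.≤-Reasoning

  *-congʳ : ∀ z → x ≃ y → x *ᴿ z ≃ y *ᴿ z
  *-congʳ {x} {y} z x≃y = ⌈ (λ ε 0<ε →
    let K , 0<K , ∣z∣≤K = bounded z
        δ , 0<δ , δK≡ε = *-quotient K ε 0<K 0<ε
    in eventually-zip
      (λ n x~y z≤K → begin
        ∣ seq x n ℚ.* seq z n ℚ.- seq y n ℚ.* seq z n ∣
          ≡⟨ cong ∣_∣ (factor (seq x n) (seq y n) (seq z n)) ⟩
        ∣ (seq x n ℚ.- seq y n) ℚ.* seq z n ∣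
          ≡⟨ ℚ.∣p*q∣≡∣p∣*∣q∣ (seq x n ℚ.- seq y n) (seq z n) ⟩
        ∣ seq x n ℚ.- seq y n ∣ ℚ.* ∣ seq z n ∣
          ≤⟨ ℚ.*-monoʳ-≤-nonNeg ∣ seq z n ∣ {{ℚ.nonNegative (ℚ.0≤∣p∣ (seq z n))}} x~y ⟩
        δ ℚ.* ∣ seq z n ∣
          ≤⟨ ℚ.*-monoˡ-≤-nonNeg δ {{ℚ.nonNegative (ℚ.<⇒≤ 0<δ)}} z≤K ⟩
        δ ℚ.* K
          ≡⟨ δK≡ε ⟩
        ε ∎)
      (⌊ x≃y ⌋ δ 0<δ) ∣z∣≤K) ⌉
    where
    open ℚ.≤-Reasoning
    factor : ∀ a b c → a ℚ.* c ℚ.- b ℚ.* c ≡ (a ℚ.- b) ℚ.* c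
    factor = solve 3 (λ a b c → a :* c :- b :* c := (a :- b) :* c) refl

  +-assoc : ∀ x y z → x +ᴿ y +ᴿ z ≃ x +ᴿ (y +ᴿ z)
  +-assoc x y z = ≃-pointwise λ n → ℚ.+-assoc (seq x n) (seq y n) (seq z n)

  +-comm : ∀ x y → x +ᴿ y ≃ y +ᴿ x
  +-comm x y = ≃-pointwise λ n → ℚ.+-comm (seq x n) (seq y n)

  +-identityʳ : ∀ x → x +ᴿ 0ℝ ≃ x
  +-identityʳ x = ≃-pointwise λ n → ℚ.+-identityʳ (seq x n)

  -ᴿ≃-1* : ∀ x → -ᴿ x ≃ fromℚ (ℚ.- 1ℚ) *ᴿ x
  -ᴿ≃-1* x = ≃-refl

  +-inverseʳ : ∀ x → x +ᴿ -ᴿ x ≃ 0ℝ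
  +-inverseʳ x = ≃-pointwise λ n →
    solve 1 (λ x → x :+ con (ℚ.- 1ℚ) :* x := con 0ℚ) refl (seq x n)

  *-assoc : ∀ x y z → x *ᴿ y *ᴿ z ≃ x *ᴿ (y *ᴿ z)
  *-assoc x y z = ≃-pointwise λ n → ℚ.*-assoc (seq x n) (seq y n) (seq z n)

  *-comm : ∀ x y → x *ᴿ y ≃ y *ᴿ x
  *-comm x y = ≃-pointwise λ n → ℚ.*-comm (seq x n) (seq y n)

  *-identityʳ : ∀ x → x *ᴿ 1ℝ ≃ x
  *-identityʳ x = ≃-pointwise λ n → ℚ.*-identityʳ (seq x n)

  *-distribʳ-+ : ∀ x y z → (y +ᴿ z) *ᴿ x ≃ y *ᴿ x +ᴿ z *ᴿ x
  *-distribʳ-+ x y z = ≃-pointwise λ n → ℚ.*-distribʳ-+ (seq x n) (seq y n) (seq z n)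

+-cong : x ≃ y → u ≃ v → x +ᴿ u ≃ y +ᴿ v
+-cong x≃y u≃v =
  ≲-antisym (+-mono-≲ (≃⇒≲ x≃y) (≃⇒≲ u≃v)) (+-mono-≲ (≃⇒≳ x≃y) (≃⇒≳ u≃v))

*-cong : x ≃ y → u ≃ v → x *ᴿ u ≃ y *ᴿ v
*-cong {x} {y} {u} {v} x≃y u≃v = ≃-trans (*-congʳ u x≃y)
  (≃-trans (*-comm y u) (≃-trans (*-congʳ y u≃v) (*-comm v y)))

-ᴿ-cong : x ≃ y → -ᴿ x ≃ -ᴿ y
-ᴿ-cong {x} {y} x≃y =
  ≃-trans (-ᴿ≃-1* x) (≃-trans (*-cong ≃-refl x≃y) (≃-sym (-ᴿ≃-1* y)))

ℝ-setoid : Setoid 0ℓ 0ℓ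
ℝ-setoid = record
  { Carrier = ℝ
  ; _≈_ = _≃_
  ; isEquivalence = record { refl = ≃-refl ; sym = ≃-sym ; trans = ≃-trans } }

ℝ-commutativeRing : CommutativeRing 0ℓ 0ℓ
ℝ-commutativeRing = record
  { _≈_ = _≃_
  ; _+_ = _+ᴿ_
  ; _*_ = _*ᴿ_
  ; -_ = -ᴿ_
  ; 0# = 0ℝ
  ; 1# = 1ℝ
  ; isCommutativeRing = record
    { isRing = record
      { +-isAbelianGroup = record
        { isGroup = record
          { isMonoid = record
            { isSemigroup = record
              { isMagma = record
                { isEquivalence = Setoid.isEquivalence ℝ-setoid
                ; ∙-cong = +-cong }
              ; assoc = +-assoc }
            ; identity = comm∧idʳ⇒id +-comm +-identityʳ }
          ; inverse = comm∧invʳ⇒inv +-comm +-inverseʳ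
          ; ⁻¹-cong = -ᴿ-cong }
        ; comm = +-comm }
      ; *-cong = *-cong
      ; *-assoc = *-assoc
      ; *-identity = comm∧idʳ⇒id *-comm *-identityʳ
      ; distrib = comm∧distrʳ⇒distr +-cong *-comm *-distribʳ-+ }
    ; *-comm = *-comm } }
  where open Consequences ℝ-setoid

-- Vanishing and apartness from zero.

null⇒≃0 : (∀ ε → 0ℚ ℚ.< ε → Eventually (λ n → ∣ seq x n ∣ ℚ.≤ ε)) → x ≃ 0ℝ
null⇒≃0 {x} h = ⌈ (λ ε 0<ε → eventually-map
  (λ n → subst (ℚ._≤ ε) (cong ∣_∣ (sym (ℚ.+-identityʳ (seq x n))))) (h ε 0<ε)) ⌉

≃0⇒null : x ≃ 0ℝ → ∀ ε → 0ℚ ℚ.< ε → Eventually (λ n → ∣ seq x n ∣ ℚ.≤ ε)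
≃0⇒null {x} x≃0 ε 0<ε = eventually-map
  (λ n → subst (ℚ._≤ ε) (cong ∣_∣ (ℚ.+-identityʳ (seq x n)))) (⌊ x≃0 ⌋ ε 0<ε)

-- A decidable substitute for the question whether `x` is zero: beyond `N` the sequence stays within
-- half of `ε` of its term at `N`, so comparing that single rational with half of `ε` settles the
-- alternative.
small-or-apart : ∀ x ε → 0ℚ ℚ.< ε →
  Eventually (λ n → ∣ seq x n ∣ ℚ.≤ ε) ⊎
  (∃ λ δ → 0ℚ ℚ.< δ × Eventually (λ n → δ ℚ.≤ ∣ seq x n ∣))
small-or-apart x ε 0<ε with cauchy x (½ ℚ.* ε) (½-pos 0<ε)
... | N , X with ∣ seq x N ∣ ℚ.≤? ½ ℚ.* ε
... | yes x≤½ε = inj₁ (N , λ n N≤n → begin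
    ∣ seq x n ∣
      ≡⟨ cong ∣_∣ (solve 2 (λ a b → a := (a :- b) :+ b) refl (seq x n) (seq x N)) ⟩
    ∣ (seq x n ℚ.- seq x N) ℚ.+ seq x N ∣
      ≤⟨ ℚ.∣p+q∣≤∣p∣+∣q∣ (seq x n ℚ.- seq x N) (seq x N) ⟩
    ∣ seq x n ℚ.- seq x N ∣ ℚ.+ ∣ seq x N ∣
      ≤⟨ ℚ.+-mono-≤ (X n N N≤n ℕ.≤-refl) x≤½ε ⟩
    ½ ℚ.* ε ℚ.+ ½ ℚ.* ε
      ≡⟨ halves ε ⟩
    ε ∎)
  where open ℚ.≤-Reasoning
-- Later terms can fall below the absolute value at `N` by at most half of `ε`; `δ` is what remains.
... | no x≰½ε = inj₂ (δ ,
    subst (ℚ._< δ) (ℚ.+-inverseʳ (½ ℚ.* ε)) (ℚ.+-monoˡ-< (ℚ.- (½ ℚ.* ε)) (ℚ.≰⇒> x≰½ε)) ,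
    N , λ n N≤n → ≤+⇒-≤ _ _ (begin
    ∣ seq x N ∣
      ≡⟨ cong ∣_∣ (solve 2 (λ a b → a := (a :- b) :+ b) refl (seq x N) (seq x n)) ⟩
    ∣ (seq x N ℚ.- seq x n) ℚ.+ seq x n ∣
      ≤⟨ ℚ.∣p+q∣≤∣p∣+∣q∣ (seq x N ℚ.- seq x n) (seq x n) ⟩
    ∣ seq x N ℚ.- seq x n ∣ ℚ.+ ∣ seq x n ∣
      ≤⟨ ℚ.+-monoˡ-≤ ∣ seq x n ∣ (X N n ℕ.≤-refl N≤n) ⟩
    ½ ℚ.* ε ℚ.+ ∣ seq x n ∣ ∎))
  where
  open ℚ.≤-Reasoning
  δ = ∣ seq x N ∣ ℚ.- ½ ℚ.* ε

-- Vanishing is a separate claim for each `ε`. At each `ε` the only alternative to smallness is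
-- apartness, which refutes `x ≃ 0ℝ` and so contradicts the double negation.
≃0-stable : ¬ ¬ x ≃ 0ℝ → x ≃ 0ℝ
≃0-stable {x} ¬¬x≃0 = null⇒≃0 λ ε 0<ε → small ε (small-or-apart x ε 0<ε)
  where
  small : ∀ ε → _ ⊎ _ → Eventually (λ n → ∣ seq x n ∣ ℚ.≤ ε)
  small ε (inj₁ x≤ε) = x≤ε
  small ε (inj₂ (δ , 0<δ , N , δ≤x)) = ⊥-elim (¬¬x≃0 λ x≃0 →
    let M , x≤½δ = ≃0⇒null x≃0 (½ ℚ.* δ) (½-pos 0<δ)
        n = M ⊔ N
    in ℚ.<-irrefl refl (ℚ.<-≤-trans (½δ<δ 0<δ)
         (ℚ.≤-trans (δ≤x n (ℕ.m≤n⊔m M N)) (x≤½δ n (ℕ.m≤m⊔n M N)))))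
    where
    ½δ<δ : ∀ {δ} → 0ℚ ℚ.< δ → ½ ℚ.* δ ℚ.< δ
    ½δ<δ {δ} 0<δ = subst₂ ℚ._<_ (ℚ.+-identityʳ (½ ℚ.* δ)) (halves δ)
      (ℚ.+-monoʳ-< (½ ℚ.* δ) (½-pos 0<δ))

1≉0 : ¬ 1ℝ ≃ 0ℝ
1≉0 1≃0 with ≃0⇒null 1≃0 ½ (ℚ.positive⁻¹ ½)
... | N , 1≤½ = ℚ.<-irrefl refl
  -- One half is less than one: after cross-multiplication this reads 1 < 2.
  (ℚ.<-≤-trans (ℚ.*<* (ℤ.+<+ (ℕ.n<1+n 1))) (1≤½ N ℕ.≤-refl))

-- Products, signs and small perturbations of reals.

<⇒≲ : x < y → x ≲ y
<⇒≲ {x} (δ , 0<δ , x+δ≤y) = ≲-pointwise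
  (eventually-map (λ n → ℚ.≤-trans (subst (ℚ._≤ seq x n ℚ.+ δ) (ℚ.+-identityʳ (seq x n))
    (ℚ.+-monoʳ-≤ (seq x n) (ℚ.<⇒≤ 0<δ)))) x+δ≤y)

-- Demanded for every step up to `η`, so that the minimum over finitely many edges serves them all.
NonNegPerturbation : ℝ → ℝ → ℚ → Set
NonNegPerturbation w z η = ∀ ε → 0ℚ ℚ.< ε → ε ℚ.≤ η → 0ℝ ≲ w +ᴿ fromℚ ε *ᴿ z

opaque
  unfolding _+ᴿ_

  -- If `y` were eventually at least `δ` in absolute value, then smallness of the product at
  -- tolerance `η ℚ.* δ` would make `x` small at every `η`, against `x≉0`. So `y` is small at every
  -- tolerance.
  *-integral : x *ᴿ y ≃ 0ℝ → ¬ x ≃ 0ℝ → y ≃ 0ℝ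
  *-integral {x} {y} xy≃0 x≉0 = null⇒≃0 λ ε 0<ε → small ε (small-or-apart y ε 0<ε)
    where
    open ℚ.≤-Reasoning
    small : ∀ ε →
      Eventually (λ n → ∣ seq y n ∣ ℚ.≤ ε) ⊎
      (∃ λ δ → 0ℚ ℚ.< δ × Eventually (λ n → δ ℚ.≤ ∣ seq y n ∣)) →
      Eventually (λ n → ∣ seq y n ∣ ℚ.≤ ε)
    small ε (inj₁ y≤ε) = y≤ε
    small ε (inj₂ (δ , 0<δ , δ≤y)) = ⊥-elim (x≉0 (null⇒≃0 λ η 0<η →
      eventually-zip
        (λ n xy≤ηδ δ≤yₙ → ℚ.*-cancelʳ-≤-pos δ {{ℚ.positive 0<δ}} (begin
          ∣ seq x n ∣ ℚ.* δ
            ≤⟨ ℚ.*-monoˡ-≤-nonNeg ∣ seq x n ∣ {{ℚ.nonNegative (ℚ.0≤∣p∣ (seq x n))}} δ≤yₙ ⟩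
          ∣ seq x n ∣ ℚ.* ∣ seq y n ∣
            ≡⟨ sym (ℚ.∣p*q∣≡∣p∣*∣q∣ (seq x n) (seq y n)) ⟩
          ∣ seq x n ℚ.* seq y n ∣
            ≤⟨ xy≤ηδ ⟩
          η ℚ.* δ ∎))
        (≃0⇒null xy≃0 (η ℚ.* δ) (*-pos 0<η 0<δ)) δ≤y))

  0≲x² : ∀ x → 0ℝ ≲ x *ᴿ x
  0≲x² x = ≲-pointwise (always λ n → square (seq x n))
    where
    square : ∀ q → 0ℚ ℚ.≤ q ℚ.* q
    square q = [ (λ eq → subst (0ℚ ℚ.≤_) (cong₂ ℚ._*_ eq eq) 0≤∣q∣²)
               , (λ eq → subst (0ℚ ℚ.≤_) (trans (cong₂ ℚ._*_ eq eq) (neg-square q)) 0≤∣q∣²) ]′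
               (ℚ.∣p∣≡p∨∣p∣≡-p q)
      where
      neg-square : ∀ q → ℚ.- q ℚ.* ℚ.- q ≡ q ℚ.* q
      neg-square = solve 1 (λ q → :- q :* :- q := q :* q) refl
      0≤∣q∣² : 0ℚ ℚ.≤ ∣ q ∣ ℚ.* ∣ q ∣
      0≤∣q∣² = subst (ℚ._≤ ∣ q ∣ ℚ.* ∣ q ∣) (ℚ.*-zeroʳ ∣ q ∣)
        (ℚ.*-monoˡ-≤-nonNeg ∣ q ∣ {{ℚ.nonNegative (ℚ.0≤∣p∣ q)}} (ℚ.0≤∣p∣ q))

  x≲x+y⇒0≲y : x ≲ x +ᴿ y → 0ℝ ≲ y
  x≲x+y⇒0≲y {x} {y} h = ⟨ (λ ε 0<ε → eventually-map
    (λ n hₙ → subst₂ ℚ._≤_ (ℚ.+-inverseˡ (seq x n)) (cancel (seq x n) (seq y n) ε)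
      (ℚ.+-monoʳ-≤ (ℚ.- seq x n) hₙ))
    (unwrap h ε 0<ε)) ⟩
    where
    cancel : ∀ a b c → ℚ.- a ℚ.+ (a ℚ.+ b ℚ.+ c) ≡ b ℚ.+ c
    cancel = solve 3 (λ a b c → :- a :+ (a :+ b :+ c) := b :+ c) refl

  0≲qx⇒0≲x : ∀ {q} → 0ℚ ℚ.< q → 0ℝ ≲ fromℚ q *ᴿ x → 0ℝ ≲ x
  0≲qx⇒0≲x {x} {q} 0<q h = ⟨ (λ ε 0<ε → eventually-map
    (λ n hₙ → ℚ.*-cancelˡ-≤-pos q {{ℚ.positive 0<q}}
      (subst₂ ℚ._≤_ (sym (ℚ.*-zeroʳ q)) (sym (ℚ.*-distribˡ-+ q (seq x n) ε)) hₙ))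
    (unwrap h (q ℚ.* ε) (*-pos 0<q 0<ε))) ⟩

  0≲-x⇒x≲0 : 0ℝ ≲ -ᴿ x → x ≲ 0ℝ
  0≲-x⇒x≲0 {x} h = ⟨ (λ ε 0<ε → eventually-map
    (λ n hₙ → subst₂ ℚ._≤_ (ℚ.+-identityʳ (seq x n)) (cancel (seq x n) ε)
      (ℚ.+-monoʳ-≤ (seq x n) hₙ))
    (unwrap h ε 0<ε)) ⟩
    where
    cancel : ∀ a c → a ℚ.+ (ℚ.- 1ℚ ℚ.* a ℚ.+ c) ≡ 0ℚ ℚ.+ c
    cancel = solve 2 (λ a c → a :+ (con (ℚ.- 1ℚ) :* a :+ c) := con 0ℚ :+ c) refl

  -- Eventually `w` is at least `δ` and the absolute value of `z` at most `K`. With `η` equal to `δ`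
  -- over `K`, a step up to `η` lowers `w` by at most `δ`.
  perturb : ∀ {w} z → 0ℝ < w → ∃ λ η → 0ℚ ℚ.< η × NonNegPerturbation w z η
  perturb {w} z (δ , 0<δ , δ≤w) =
    let K , 0<K , ∣z∣≤K = bounded z
        η , 0<η , ηK≡δ = *-quotient K δ 0<K 0<δ
    in η , 0<η , λ ε 0<ε ε≤η → ≲-pointwise
      (eventually-zip
        (λ n δ≤wₙ zₙ≤K → begin
          0ℚ
            ≡⟨ sym (ℚ.+-inverseʳ δ) ⟩
          δ ℚ.- δ
            ≤⟨ ℚ.+-mono-≤ (subst (ℚ._≤ seq w n) (ℚ.+-identityˡ δ) δ≤wₙ)
                 (subst (ℚ.- δ ℚ.≤_) (minus ε (seq z n)) (ℚ.neg-antimono-≤ (begin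
              ε ℚ.* ℚ.- seq z n
                ≤⟨ ℚ.*-monoˡ-≤-nonNeg ε {{ℚ.nonNegative (ℚ.<⇒≤ 0<ε)}}
                     (ℚ.≤-trans (p≤∣p∣ (ℚ.- seq z n))
                       (subst (ℚ._≤ K) (sym (ℚ.∣-p∣≡∣p∣ (seq z n))) zₙ≤K)) ⟩
              ε ℚ.* K
                ≤⟨ ℚ.*-monoʳ-≤-nonNeg K {{ℚ.nonNegative (ℚ.<⇒≤ 0<K)}} ε≤η ⟩
              η ℚ.* K
                ≡⟨ ηK≡δ ⟩
              δ ∎))) ⟩
          seq w n ℚ.+ ε ℚ.* seq z n ∎)
        δ≤w ∣z∣≤K)
    where
    open ℚ.≤-Reasoning
    minus : ∀ a b → ℚ.- (a ℚ.* ℚ.- b) ≡ a ℚ.* b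
    minus = solve 2 (λ a b → :- (a :* :- b) := a :* b) refl

perturb-all : ∀ {m} (w z : Vector ℝ m) → (∀ e → 0ℝ < w e) →
              ∃ λ η → 0ℚ ℚ.< η × (∀ e → NonNegPerturbation (w e) (z e) η)
perturb-all {zero} w z 0<w = 1ℚ , 0<1 , λ ()
perturb-all {suc m} w z 0<w =
  let α , 0<α , first = perturb {w zero} (z zero) (0<w zero)
      β , 0<β , rest = perturb-all (λ e → w (suc e)) (λ e → z (suc e)) (λ e → 0<w (suc e))
  in α ℚ.⊓ β , ⊓-pos α β 0<α 0<β , λ where
    zero    ε 0<ε ε≤η → first ε 0<ε (ℚ.≤-trans ε≤η (ℚ.p⊓q≤p α β))
    (suc e) ε 0<ε ε≤η → rest e ε 0<ε (ℚ.≤-trans ε≤η (ℚ.p⊓q≤q α β))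
  where
  ⊓-pos : ∀ α β → 0ℚ ℚ.< α → 0ℚ ℚ.< β → 0ℚ ℚ.< α ℚ.⊓ β
  ⊓-pos α β 0<α 0<β with ℚ.⊓-sel α β
  ... | inj₁ eq = subst (0ℚ ℚ.<_) (sym eq) 0<α
  ... | inj₂ eq = subst (0ℚ ℚ.<_) (sym eq) 0<β

-- Instances that an algorithm cannot tell apart.

queries : ∀ {n} → Algorithm n → SetFunction n → List (Subset n)
queries (output S r) f = []
queries (query S k)  f = S ∷ queries (k (f S)) f

length-queries : ∀ {n} (A : Algorithm n) f → length (queries A f) ≡ queryCount A f
length-queries (output S r) f = refl
length-queries (query S k)  f = cong ℕ.suc (length-queries (k (f S)) f)

run-cong : ∀ {n} (A : Algorithm n) f g →
           (∀ S → S ∈ᴸ queries A f → g S ≡ f S) → run A g ≡ run A f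
run-cong (output S r) f g agree = refl
run-cong (query S k)  f g agree rewrite agree S (here refl) =
  run-cong (k (f S)) f g λ U U∈ → agree U (there U∈)

-- Reconciles two notions of equality: the values on `Ss` are literally those of `f`, while the
-- whole function is `_≃_` to `h` as soon as `f` and `h` are so on `Ss`.
override : ∀ {n} → List (Subset n) → SetFunction n → SetFunction n → SetFunction n
override Ss f h S with DecMembership._∈?_ (≡-dec Bool._≟_) S Ss
... | yes _ = f S
... | no  _ = h S

override-∈ : ∀ {n} {Ss} (f h : SetFunction n) S → S ∈ᴸ Ss → override Ss f h S ≡ f S
override-∈ {Ss = Ss} f h S S∈ with DecMembership._∈?_ (≡-dec Bool._≟_) S Ss
... | yes _  = refl
... | no  S∉ = ⊥-elim (S∉ S∈)

override-≃ : ∀ {n} Ss (f h : SetFunction n) → (∀ S → S ∈ᴸ Ss → f S ≃ h S) →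
             ∀ S → override Ss f h S ≃ h S
override-≃ Ss f h f≃h S with DecMembership._∈?_ (≡-dec Bool._≟_) S Ss
... | yes S∈ = f≃h S S∈
... | no  _  = ≃-refl

module _ {n} (P : Problem n) where
  open Problem P

  -- The shared answer `(U , r)` gives the chain `f S ≲ f U ≃ r ≃ g U ≲ g S`.
  correct⇒≲ : ∀ {f g answer S} → Correct P f answer → Correct P g answer →
    Feasible S → (∀ U → Feasible U → f S ≲ f U) → f S ≲ g S
  correct⇒≲ {f} {g} {U , r} {S} (U-feasible , _ , r≈fU) (_ , gU≤ , r≈gU) S-feasible minimal =
    ≲-trans (minimal U U-feasible) (≲-trans (≃⇒≳ {r} {f U} ⌈ r≈fU ⌉)
      (≲-trans (≃⇒≲ {r} {g U} ⌈ r≈gU ⌉) ⟨ gU≤ S S-feasible ⟩))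

  -- An algorithm may inspect the Cauchy sequences of the answers, so the second
  -- instance must return the very sequences of f on the queried sets.
  indistinguishable⇒≲ : ∀ A → (∀ f → Instance f → Correct P f (run A f)) →
    ∀ f h → Instance f → Instance (override (queries A f) f h) →
    (∀ S → S ∈ᴸ queries A f → f S ≃ h S) →
    ∀ S → Feasible S → (∀ U → Feasible U → f S ≲ f U) → f S ≲ h S
  indistinguishable⇒≲ A correct f h f-instance g-instance f≃h S feasible minimal =
    ≲-trans
      (correct⇒≲ {f} {g} {run A f} {S} (correct f f-instance)
        (subst (Correct P g) (run-cong A f g (override-∈ f h)) (correct g g-instance))
        feasible minimal)
      (≃⇒≲ (override-≃ (queries A f) f h f≃h S))
    where
    g : SetFunction n
    g = override (queries A f) f h

-- From unseen directions to the query bound.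

open LinearAlgebra ℝ-commutativeRing
open Ordered _≲_ ≃⇒≲ ≲-trans ≲-antisym +-mono-≲

opaque
  unfolding _+ᴿ_

  +≡+ᴿ : ∀ x y → x Defs.+ y ≡ x +ᴿ y
  +≡+ᴿ x y = refl

  combination≡∙ : ∀ {k m} (c : Vector ℝ k) (b : Vector (Vector ℝ m) k) e →
                  combination c b e ≡ c ∙ (λ i → b i e)
  combination≡∙ c b e = refl

  cutValue≡↾ : ∀ {N} o (G : Graph N) S → cutValue o G S ≡ Graph.weight G ↾ isCut o G S
  cutValue≡↾ o G S = refl

module _ {n m} (P : Problem n) (χ : Subset n → Fin m → Bool)
         (w : Vector ℝ m) (0<w : ∀ e → 0ℝ < w e) where
  open Problem P

  Minimizer : Subset n → Set
  Minimizer S = Feasible S × (∀ U → Feasible U → w ↾ χ S ≲ w ↾ χ U)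

  module _
    -- Stated for every `f` that is `_≃_` to a cut function, because an overridden function is a cut
    -- function only up to `_≃_`.
    (isInstance : ∀ u → (∀ e → 0ℝ ≲ u e) → ∀ f → (∀ S → f S ≃ u ↾ χ S) → Instance f)
    where

    private
      f : SetFunction n
      f S = w ↾ χ S

    f-instance : Instance f
    f-instance = isInstance w (λ e → <⇒≲ (0<w e)) f λ S → ≃-refl

    module _ (A : Algorithm n) (correct : ∀ h → Instance h → Correct P h (run A h)) where

      Unseen : Vector ℝ m → Set
      Unseen z = ∀ S → S ∈ᴸ queries A f → z ↾ χ S ≃ 0ℝ

      unseen⇒0≲ : ∀ z → Unseen z → ∀ S → Minimizer S → 0ℝ ≲ z ↾ χ S
      unseen⇒0≲ z unseen S (feasible , minimal) =
        let ε , 0<ε , 0≲w+ = perturb-all w z 0<w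
            w′ : Vector ℝ m
            w′ = λ e → w e +ᴿ fromℚ ε *ᴿ z e
            h : SetFunction n
            h = λ V → w′ ↾ χ V
            f≃h : ∀ V → V ∈ᴸ queries A f → f V ≃ h V
            f≃h = λ V V∈ → ↾-shift-null w (fromℚ ε) z (χ V) (unseen V V∈)
            f≲h : f S ≲ h S
            f≲h = indistinguishable⇒≲ P A correct f h f-instance
              (isInstance w′ (λ e → 0≲w+ e ε 0<ε ℚ.≤-refl) (override (queries A f) f h)
                (override-≃ (queries A f) f h f≃h))
              f≃h S feasible minimal
        in 0≲qx⇒0≲x 0<ε (x≲x+y⇒0≲y (≲-trans f≲h (≃⇒≲ (↾-shift w (fromℚ ε) z (χ S)))))

      -- Unseen directions are closed under negation, so the one-sided bound applies to `z` and to
      -- its negative.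
      unseen⇒≃0 : ∀ z → Unseen z → ∀ S → Minimizer S → z ↾ χ S ≃ 0ℝ
      unseen⇒≃0 z unseen S minimizer = ≲-antisym
        (0≲-x⇒x≲0 (≲-trans (unseen⇒0≲ (λ e → -1ℝ *ᴿ z e) -z-unseen S minimizer)
          (≃⇒≲ (≃-trans (↾-* -1ℝ z (χ S)) (≃-sym (-ᴿ≃-1* (z ↾ χ S)))))))
        (unseen⇒0≲ z unseen S minimizer)
        where
        -1ℝ = fromℚ (ℚ.- 1ℚ)
        -z-unseen : Unseen (λ e → -1ℝ *ᴿ z e)
        -z-unseen V V∈ = ↾-*-null -1ℝ z (χ V) (unseen V V∈)

      ⟂queries⇒⟂minimizer : ∀ z →
        (∀ i → z ∙ indicator (χ (List.lookup (queries A f) i)) ≃ 0ℝ) →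
        ∀ S → Minimizer S → z ∙ indicator (χ S) ≃ 0ℝ
      ⟂queries⇒⟂minimizer z z⟂ S minimizer = ≃-trans (≃-sym (↾≈∙ z (χ S)))
        (unseen⇒≃0 z unseen S minimizer)
        where
        unseen : Unseen z
        unseen V V∈ = ≃-trans (↾≈∙ z (χ V))
          (subst (λ V → z ∙ indicator (χ V) ≃ 0ℝ) (sym (lookup-index V∈)) (z⟂ (Any.index V∈)))

    -- Orthogonality to the queried cuts passes from the minimizers to their span and hence to its
    -- basis `b`. The queried cuts are listed with repetition, so their number is the query count.
    lower-bound : ∀ {d} (G : Vector ℝ m → Set) →
      (∀ v → G v → ∃ λ S → Minimizer S × (∀ e → v e ≃ indicator (χ S) e)) →
      HasDimension (Span G) d → QueryComplexityAtLeast P d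
    lower-bound {d} G minimizer (b , b∈span , independent , _) q (A , solves) =
      ℕ.≤-trans (subst (d ≤ᴺ_) (length-queries A f)
        (orthogonality⇒≤ 1≉0 ≃0-stable *-integral 0≲x²
          (λ i → indicator (χ (List.lookup (queries A f) i))) b
          (λ c cb≃0 j → ⌈ independent c
            (λ e → ⌊ subst (_≃ 0ℝ) (sym (combination≡∙ c b e)) (cb≃0 e) ⌋) j ⌉)
          ⟂queries⇒⟂b))
        (proj₂ (solves f f-instance))
      where
      correct : ∀ h → Instance h → Correct P h (run A h)
      correct h h-instance = proj₁ (solves h h-instance)
      ⟂queries⇒⟂b : ∀ z → (∀ i → z ∙ indicator (χ (List.lookup (queries A f) i)) ≃ 0ℝ) →
                    ∀ j → z ∙ b j ≃ 0ℝ
      ⟂queries⇒⟂b z z⟂ j =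
        let k , c , v , v∈G , bⱼ≋cv = b∈span j
        in ⟂-combination z (b j) c v (λ e → subst (b j e ≃_) (combination≡∙ c v e) ⌈ bⱼ≋cv e ⌉) λ i →
          let S , S-minimizer , v≃χ = minimizer (v i) (v∈G i)
          in ≃-trans (∙-cong {x = z} (λ _ → ≃-refl) v≃χ)
               (⟂queries⇒⟂minimizer A correct z z⟂ S S-minimizer)

-- Submodularity of cut functions.

-- A Boolean-valued quantifier: a claim about all sixteen assignments to four Booleans evaluates to
-- `true` and is proved by `tt`.
∀ᵇ : (Bool → Bool) → Bool
∀ᵇ p = p false ∧ p true

∀ᵇ-elim : ∀ p → T (∀ᵇ p) → ∀ b → T (p b)
∀ᵇ-elim p h false with true ← p false = tt
∀ᵇ-elim p h true  with true ← p false = h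

∀ᵇ⁴-elim : ∀ (p : Bool → Bool → Bool → Bool → Bool) →
  T (∀ᵇ λ a → ∀ᵇ λ b → ∀ᵇ λ c → ∀ᵇ (p a b c)) → ∀ a b c d → T (p a b c d)
∀ᵇ⁴-elim p h a b c = ∀ᵇ-elim (p a b c) (∀ᵇ-elim (λ c → ∀ᵇ (p a b c))
  (∀ᵇ-elim (λ b → ∀ᵇ λ c → ∀ᵇ (p a b c))
    (∀ᵇ-elim (λ a → ∀ᵇ λ b → ∀ᵇ λ c → ∀ᵇ (p a b c)) h a) b) c)

cut : Orientation → Bool → Bool → Bool
cut directed   a b = a ∧ not b
cut undirected a b = a xor b

-- For a single edge, `a` and `a′` record whether its tail lies in `X` and in `Y`, and `b` and `b′`
-- do so for its head. The union and intersection together cut the edge no more often than `X` and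
-- `Y` do: this is checked for one cut and for two.
uncrosses-∨ uncrosses-∧ : Orientation → Bool → Bool → Bool → Bool → Bool
uncrosses-∨ o a a′ b b′ =
  not (cut o (a ∨ a′) (b ∨ b′) ∨ cut o (a ∧ a′) (b ∧ b′)) ∨ (cut o a b ∨ cut o a′ b′)
uncrosses-∧ o a a′ b b′ =
  not (cut o (a ∨ a′) (b ∨ b′) ∧ cut o (a ∧ a′) (b ∧ b′)) ∨ (cut o a b ∧ cut o a′ b′)

cut-uncrosses-∨ : ∀ o a a′ b b′ → T (uncrosses-∨ o a a′ b b′)
cut-uncrosses-∨ directed   = ∀ᵇ⁴-elim (uncrosses-∨ directed) tt
cut-uncrosses-∨ undirected = ∀ᵇ⁴-elim (uncrosses-∨ undirected) tt

cut-uncrosses-∧ : ∀ o a a′ b b′ → T (uncrosses-∧ o a a′ b b′)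
cut-uncrosses-∧ directed   = ∀ᵇ⁴-elim (uncrosses-∧ directed) tt
cut-uncrosses-∧ undirected = ∀ᵇ⁴-elim (uncrosses-∧ undirected) tt

isCut≡cut : ∀ {N} o (G : Graph N) S e → let open Graph G in
            isCut o G S e ≡ cut o (lookup S (tail e)) (lookup S (head e))
isCut≡cut directed   G S e = refl
isCut≡cut undirected G S e = refl

module _ {N} (o : Orientation) (G : Graph N) where
  open Graph G

  cutWeight-submodular : ∀ u → (∀ e → 0ℝ ≲ u e) → ∀ X Y →
    u ↾ isCut o G (X ∪ Y) +ᴿ u ↾ isCut o G (X ∩ Y) ≲ u ↾ isCut o G X +ᴿ u ↾ isCut o G Y
  cutWeight-submodular u 0≲u X Y = ↾-mono-≤
    (isCut o G (X ∪ Y)) (isCut o G (X ∩ Y)) (isCut o G X) (isCut o G Y) 0≲u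
    (λ e → transport e (λ p q r s → T (not (p ∨ q) ∨ (r ∨ s)))
      (cut-uncrosses-∨ o X[ tail e ] Y[ tail e ] X[ head e ] Y[ head e ]))
    (λ e → transport e (λ p q r s → T (not (p ∧ q) ∨ (r ∧ s)))
      (cut-uncrosses-∧ o X[ tail e ] Y[ tail e ] X[ head e ] Y[ head e ]))
    where
    X[_] Y[_] : Fin N → Bool
    X[_] = lookup X
    Y[_] = lookup Y
    zip-cut : ∀ (_⊙_ : Bool → Bool → Bool) e → isCut o G (zipWith _⊙_ X Y) e ≡
              cut o (X[ tail e ] ⊙ Y[ tail e ]) (X[ head e ] ⊙ Y[ head e ])
    zip-cut _⊙_ e = trans (isCut≡cut o G (zipWith _⊙_ X Y) e)
      (cong₂ (cut o) (lookup-zipWith _⊙_ (tail e) X Y) (lookup-zipWith _⊙_ (head e) X Y))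
    transport : ∀ e (Q : Bool → Bool → Bool → Bool → Set) →
      Q (cut o (X[ tail e ] ∨ Y[ tail e ]) (X[ head e ] ∨ Y[ head e ]))
        (cut o (X[ tail e ] ∧ Y[ tail e ]) (X[ head e ] ∧ Y[ head e ]))
        (cut o X[ tail e ] X[ head e ]) (cut o Y[ tail e ] Y[ head e ]) →
      Q (isCut o G (X ∪ Y) e) (isCut o G (X ∩ Y) e) (isCut o G X e) (isCut o G Y e)
    transport e Q h rewrite zip-cut _∨_ e | zip-cut _∧_ e
      | isCut≡cut o G X e | isCut≡cut o G Y e = h

isCut-∁ : ∀ {N} (G : Graph N) S e → isCut undirected G (∁ S) e ≡ isCut undirected G S e
isCut-∁ G S e = trans
  (cong₂ _xor_ (lookup-map (tail e) not S) (lookup-map (head e) not S))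
  (not-xor-not (lookup S (tail e)) (lookup S (head e)))
  where
  open Graph G
  not-xor-not : ∀ a b → not a xor not b ≡ a xor b
  not-xor-not false b = Bool.not-involutive b
  not-xor-not true  b = refl

≃-submodular : ∀ {n} {f g : SetFunction n} → (∀ S → f S ≃ g S) →
  (∀ X Y → g (X ∪ Y) +ᴿ g (X ∩ Y) ≲ g X +ᴿ g Y) → Submodular f
≃-submodular {f = f} f≃g g-submodular X Y = unwrap (subst₂ _≲_
  (sym (+≡+ᴿ (f (X ∪ Y)) (f (X ∩ Y)))) (sym (+≡+ᴿ (f X) (f Y)))
  (≲-trans (+-mono-≲ (≃⇒≲ (f≃g (X ∪ Y))) (≃⇒≲ (f≃g (X ∩ Y))))
  (≲-trans (g-submodular X Y) (+-mono-≲ (≃⇒≳ (f≃g X)) (≃⇒≳ (f≃g Y))))))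

-- Sets of nonterminals as s-t cuts.

insertAt-zipWith : ∀ {A B C : Set} {n} (_⊙_ : A → B → C) (xs : Vec A n) (ys : Vec B n) i a b →
  Vec.insertAt (zipWith _⊙_ xs ys) i (a ⊙ b) ≡
  zipWith _⊙_ (Vec.insertAt xs i a) (Vec.insertAt ys i b)
insertAt-zipWith _⊙_ xs       ys       zero    a b = refl
insertAt-zipWith _⊙_ (x ∷ xs) (y ∷ ys) (suc i) a b =
  cong (x ⊙ y ∷_) (insertAt-zipWith _⊙_ xs ys i a b)

module _ {n} (s t : Fin (2 + n)) (s≢t : s ≢ t) where
  private
    -- The position of `t` once `s` is removed; hence `s` is inserted last and removed first.
    t′ = punchOut s≢t

  -- [n] is identified with the vertices other than s and t, so that addTerminals
  -- turns S into the s-t cut S ∪ {s}.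
  addTerminals : Subset n → Subset (2 + n)
  addTerminals S = Vec.insertAt (Vec.insertAt S t′ false) s true

  dropTerminals : Subset (2 + n) → Subset n
  dropTerminals U = Vec.removeAt (Vec.removeAt U s) t′

  -- Covers `_∪_` and `_∩_` at once: both act bitwise and preserve the bits of the terminals, `true`
  -- at `s` and `false` at `t`.
  addTerminals-zipWith : ∀ (_⊙_ : Bool → Bool → Bool) →
    true ⊙ true ≡ true → false ⊙ false ≡ false →
    ∀ X Y → addTerminals (zipWith _⊙_ X Y) ≡ zipWith _⊙_ (addTerminals X) (addTerminals Y)
  addTerminals-zipWith _⊙_ tt≡t ff≡f X Y = begin
    Vec.insertAt (Vec.insertAt (zipWith _⊙_ X Y) t′ false) s true
      ≡⟨ cong₂ (λ a b → Vec.insertAt (Vec.insertAt (zipWith _⊙_ X Y) t′ a) s b) (sym ff≡f) (sym tt≡t) ⟩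
    Vec.insertAt (Vec.insertAt (zipWith _⊙_ X Y) t′ (false ⊙ false)) s (true ⊙ true)
      ≡⟨ cong (λ Z → Vec.insertAt Z s (true ⊙ true)) (insertAt-zipWith _⊙_ X Y t′ false false) ⟩
    Vec.insertAt (zipWith _⊙_ (Vec.insertAt X t′ false) (Vec.insertAt Y t′ false)) s (true ⊙ true)
      ≡⟨ insertAt-zipWith _⊙_ (Vec.insertAt X t′ false) (Vec.insertAt Y t′ false) s true true ⟩
    zipWith _⊙_ (addTerminals X) (addTerminals Y) ∎
    where open ≡-Reasoning

  s∈addTerminals : ∀ S → s ∈ addTerminals S
  s∈addTerminals S = lookup⇒[]= s _ (Vec.insertAt-lookup (Vec.insertAt S t′ false) s true)

  t∉addTerminals : ∀ S → t ∉ addTerminals S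
  t∉addTerminals S t∈ = Bool.not-¬ t-outside ([]=⇒lookup t∈)
    where
    t-outside : lookup (addTerminals S) t ≡ false
    t-outside = begin
      lookup (addTerminals S) t
        ≡⟨ cong (lookup (addTerminals S)) (sym (punchIn-punchOut s≢t)) ⟩
      lookup (addTerminals S) (punchIn s t′)
        ≡⟨ Vec.insertAt-punchIn (Vec.insertAt S t′ false) s true t′ ⟩
      lookup (Vec.insertAt S t′ false) t′
        ≡⟨ Vec.insertAt-lookup S t′ false ⟩
      false ∎
      where open ≡-Reasoning

  addTerminals-dropTerminals : ∀ {U} → s ∈ U → t ∉ U → addTerminals (dropTerminals U) ≡ U
  addTerminals-dropTerminals {U} s∈U t∉U = begin
    Vec.insertAt (Vec.insertAt (dropTerminals U) t′ false) s true
      ≡⟨ cong₂ (λ a b → Vec.insertAt (Vec.insertAt (dropTerminals U) t′ a) s b)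
           (sym t-outside) (sym ([]=⇒lookup s∈U)) ⟩
    Vec.insertAt (Vec.insertAt (dropTerminals U) t′ (lookup U∖s t′)) s (lookup U s)
      ≡⟨ cong (λ V → Vec.insertAt V s (lookup U s)) (Vec.insertAt-removeAt U∖s t′) ⟩
    Vec.insertAt U∖s s (lookup U s)
      ≡⟨ Vec.insertAt-removeAt U s ⟩
    U ∎
    where
    open ≡-Reasoning
    U∖s = Vec.removeAt U s
    t-outside : lookup U∖s t′ ≡ false
    t-outside = trans (Vec.removeAt-punchOut U s≢t) (Bool.¬-not λ eq → t∉U (lookup⇒[]= t U eq))

-- The bounds for s-t cuts and for global cuts.

cutValue-≲ : ∀ {N} o (G : Graph N) S U → cutValue o G S ≤ cutValue o G U →
             Graph.weight G ↾ isCut o G S ≲ Graph.weight G ↾ isCut o G U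
cutValue-≲ o G S U S≤U = subst₂ _≲_ (cutValue≡↾ o G S) (cutValue≡↾ o G U)
  (⟨_⟩ {cutValue o G S} {cutValue o G U} S≤U)

cutVector-≃ : ∀ {N} o (G : Graph N) S {v} → v ≋ cutVector o G S →
              ∀ e → v e ≃ indicator (isCut o G S) e
cutVector-≃ o G S {v} v≋ e = ⌈_⌉ {v e} {cutVector o G S e} (v≋ e)

stCutDimension⇒QueryComplexityAtLeast : ∀ {n d} o (G : Graph (2 + n)) s t → s ≢ t →
  STCutDimension o G s t d → QueryComplexityAtLeast (SFM n) d
stCutDimension⇒QueryComplexityAtLeast {n} o G s t s≢t =
  lower-bound (SFM n) χ weight positive
    (λ u 0≲u f f≃ → ≃-submodular f≃ (submodular u 0≲u))
    (λ v → ∃ λ S → STMincut o G s t S × v ≋ cutVector o G (S ∪ ⁅ s ⁆)) λ v → mincut {v}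
  where
  open Graph G
  φ = addTerminals s t s≢t
  ψ = dropTerminals s t s≢t
  χ : Subset n → Fin edges → Bool
  χ S = isCut o G (φ S)
  submodular : ∀ u → (∀ e → 0ℝ ≲ u e) → ∀ X Y →
    u ↾ χ (X ∪ Y) +ᴿ u ↾ χ (X ∩ Y) ≲ u ↾ χ X +ᴿ u ↾ χ Y
  submodular u 0≲u X Y =
    subst₂ (λ U V → u ↾ isCut o G U +ᴿ u ↾ isCut o G V ≲ u ↾ χ X +ᴿ u ↾ χ Y)
      (sym (addTerminals-zipWith s t s≢t _∨_ refl refl X Y))
      (sym (addTerminals-zipWith s t s≢t _∧_ refl refl X Y))
      (cutWeight-submodular o G u 0≲u (φ X) (φ Y))
  mincut : ∀ {v} → (∃ λ S → STMincut o G s t S × v ≋ cutVector o G (S ∪ ⁅ s ⁆)) →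
           ∃ λ S → Minimizer (SFM n) χ weight positive S × (∀ e → v e ≃ indicator (χ S) e)
  mincut {v} (S , (_ , t∉S , minimal) , v≋) =
    -- The mincut read as a subset of the nonterminals. Each `φ V` contains `s` and avoids `t`, so
    -- minimality of `U` among s-t cuts gives minimality over all `V`.
    ψ U ,
    (tt , λ V _ → subst (λ W → weight ↾ isCut o G W ≲ weight ↾ χ V) (sym φψU≡U)
      (cutValue-≲ o G U (φ V)
        (minimal (φ V) (s∈addTerminals s t s≢t V) (t∉addTerminals s t s≢t V)))) ,
    subst (λ W → ∀ e → v e ≃ indicator (isCut o G W) e) (sym φψU≡U) (cutVector-≃ o G U v≋)
    where
    U = S ∪ ⁅ s ⁆
    t∉U : t ∉ U
    t∉U t∈U with x∈p∪q⁻ S ⁅ s ⁆ t∈U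
    ... | inj₁ t∈S = t∉S t∈S
    ... | inj₂ t∈s = s≢t (sym (x∈⁅y⁆⇒x≡y s t∈s))
    φψU≡U : φ (ψ U) ≡ U
    φψU≡U = addTerminals-dropTerminals s t s≢t (x∈p∪q⁺ (inj₂ (x∈⁅x⁆ s))) t∉U

globalCutDimension⇒QueryComplexityAtLeast : ∀ {n d} o (G : Graph n) (P : Problem n) →
  let open Graph G; open Problem P in
  (∀ {S} → NonTrivial S → Feasible S) → (∀ {S} → Feasible S → NonTrivial S) →
  (∀ u → (∀ e → 0ℝ ≲ u e) → ∀ f → (∀ S → f S ≃ u ↾ isCut o G S) → Instance f) →
  GlobalCutDimension o G d → QueryComplexityAtLeast P d
globalCutDimension⇒QueryComplexityAtLeast o G P feasible nonTrivial isInstance =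
  lower-bound P (isCut o G) weight positive isInstance
    (λ v → ∃ λ S → GlobalMincut o G S × v ≋ cutVector o G S)
    λ v (S , (S-nonTrivial , minimal) , v≋) →
      S , (feasible S-nonTrivial ,
           λ U U-feasible → cutValue-≲ o G S U (minimal U (nonTrivial U-feasible))) ,
      cutVector-≃ o G S v≋
  where open Graph G

theorem1p4 : (n d : ℕ) →
    (2 ≤ᴺ n →
    (∃ λ (G : Graph n) → GlobalCutDimension undirected G d) →
    QueryComplexityAtLeast (NonTrivialSymmetricSFM n) d)
    ×
    ((∃ λ (o : Orientation) → ∃ λ (G : Graph (2 + n)) → ∃ λ s → ∃ λ t →
    s ≢ t × STCutDimension o G s t d) →
    QueryComplexityAtLeast (SFM n) d)
    ×
    (2 ≤ᴺ n →
    (∃ λ (G : Graph n) → GlobalCutDimension directed G d) →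
    QueryComplexityAtLeast (NonTrivialSFM n) d)
theorem1p4 n d =
    (λ _ (G , dimension) → globalCutDimension⇒QueryComplexityAtLeast undirected G
      (NonTrivialSymmetricSFM n) (λ p → p) (λ p → p)
      (λ u 0≲u f f≃ → ≃-submodular f≃ (cutWeight-submodular undirected G u 0≲u) ,
                      symmetric G u f f≃)
      dimension)
  , (λ (o , G , s , t , s≢t , dimension) →
      stCutDimension⇒QueryComplexityAtLeast o G s t s≢t dimension)
  , (λ _ (G , dimension) → globalCutDimension⇒QueryComplexityAtLeast directed G
      (NonTrivialSFM n) (λ p → p) (λ p → p)
      (λ u 0≲u f f≃ → ≃-submodular f≃ (cutWeight-submodular directed G u 0≲u))
      dimension)
  where
  module ℝᶜ = CommutativeRing ℝ-commutativeRing
  symmetric : ∀ (G : Graph n) u f → (∀ S → f S ≃ u ↾ isCut undirected G S) → Symmetric f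
  symmetric G u f f≃ S = ⌊ ≃-trans (f≃ S) (≃-trans
    (ℝᶜ.reflexive (SemiringSum.sum-cong-≗ ℝᶜ.semiring λ e →
      cong (λ p → if p then u e else 0ℝ) (sym (isCut-∁ G S e))))
    (≃-sym (f≃ (∁ S)))) ⌋
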